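{- For all integers $n\ge 0$, \[ b(2n+1,n)=p(2n+1,n)=EC(n). \] Moreover, there exists an explicit bijection between $B(2n+1,n)$ and $P(2n+1,n)$.
   Context: For a permutation $\pi=\pi_1\cdots\pi_m\in S_m$, a position $i\in\{1,\dots,m-1\}$ is an ascent if $\pi_i<\pi_{i+1}$ and a descent if $\pi_i>\pi_{i+1}$. The permutation $\pi$ is called ballot if for every $1\le k\le m-1$, the number of ascents among positions $1,\dots,k$ is at least the number of descents among positions $1,\dots,k$. Let $B(m,d)$ be the set of ballot permutations in $S_m$ with exactly $d$ descents and $b(m,d)=|B(m,d)|$. For a cycle $\mathfrak c=(c_1,\dots,c_k)$ of a permutation (fixed points are cycles of length 1), let $\mathrm{cA}(\mathfrak c)$ be the number of $i\in\{1,\dots,k\}$ with $c_i\le c_{i+1}$ and $\mathrm{cD}(\mathfrak c)$ the number with $c_i>c_{i+1}$, where $c_{k+1}=c_1$; let $M(\mathfrak c)=\min(\mathrm{cA}(\mathfrak c),\mathrm{cD}(\mathfrak c))$, and for a permutation $\pi$ let $M(\pi)$ be the sum of $M$ over its cycles. Let $P(m,d)$ be the set of permutations in $S_m$ all of whose cycles have odd length and with $M(\pi)=d$, and $p(m,d)=|P(m,d)|$. $E(m,d)$ is the number of permutations of $[m]$ with exactly $d$ descents. The Eulerian–Catalan numbers are $EC(n)=2E(2n,n-1)$ for $n\ge1$, and $EC(0)=1$. -}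

module Defs where

open import Data.Bool using (Bool; true; false; _∧_; _∨_; not; if_then_else_; T)
open import Data.Nat using (ℕ; zero; suc; _+_; _*_; _≤ᵇ_; _<ᵇ_; _≡ᵇ_; _⊓_)
open import Data.Fin using (Fin; toℕ)
open import Data.Vec using (Vec; []; _∷_; lookup; toList)
open import Data.List using (List; []; _∷_; _++_; map; concatMap; length; take; upTo; allFin; zip)
open import Data.Bool.ListAction using (all; any)
open import Data.Nat.ListAction using (sum)
open import Data.Product using (Σ; _×_; proj₁; proj₂)

-- Permutations of [m] are written in one-line notation as vectors
-- v : Vec (Fin m) m  (π_i = lookup v i, values 0..m-1 instead of 1..m;
-- only the order matters).

countTrue : {A : Set} → (A → Bool) → List A → ℕ
countTrue p []       = 0
countTrue p (x ∷ xs) = if p x then suc (countTrue p xs) else countTrue p xs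

allVecs : (m k : ℕ) → List (Vec (Fin m) k)
allVecs m zero    = [] ∷ []
allVecs m (suc k) = concatMap (λ i → map (i ∷_) (allVecs m k)) (allFin m)

distinct : List ℕ → Bool
distinct []       = true
distinct (x ∷ xs) = not (any (λ y → x ≡ᵇ y) xs) ∧ distinct xs

oneLine : {m : ℕ} → Vec (Fin m) m → List ℕ
oneLine v = toList (Data.Vec.map toℕ v)

isPerm : {m : ℕ} → Vec (Fin m) m → Bool
isPerm v = distinct (oneLine v)

asc : List ℕ → ℕ
asc []           = 0
asc (x ∷ [])     = 0
asc (x ∷ y ∷ ys) = (if x <ᵇ y then 1 else 0) + asc (y ∷ ys)

des : List ℕ → ℕ
des []           = 0
des (x ∷ [])     = 0
des (x ∷ y ∷ ys) = (if y <ᵇ x then 1 else 0) + des (y ∷ ys)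

-- ballot: for every k in 1..m-1, #ascents ≥ #descents among positions
-- 1..k, i.e. in the prefix of length k+1. (Prefixes of length 0,1 are
-- trivially fine, so we check all prefix lengths 0..m.)
ballot : List ℕ → Bool
ballot l = all (λ j → des (take j l) ≤ᵇ asc (take j l)) (upTo (suc (length l)))

inB : (m d : ℕ) → Vec (Fin m) m → Bool
inB m d v = isPerm v ∧ ballot (oneLine v) ∧ (des (oneLine v) ≡ᵇ d)

b : ℕ → ℕ → ℕ
b m d = countTrue (inB m d) (allVecs m m)

B : ℕ → ℕ → Set
B m d = Σ (Vec (Fin m) m) (λ v → T (inB m d v))

inE : (m d : ℕ) → Vec (Fin m) m → Bool
inE m d v = isPerm v ∧ (des (oneLine v) ≡ᵇ d)

E : ℕ → ℕ → ℕ
E m d = countTrue (inE m d) (allVecs m m)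

EC : ℕ → ℕ
EC zero    = 1
EC (suc n) = 2 * E (2 * suc n) n

-- the cycle of x under v: (x, π x, π² x, ...) until returning to x
-- (fuel m suffices for a permutation)
orbitFrom : {m : ℕ} → Vec (Fin m) m → ℕ → Fin m → Fin m → List ℕ
orbitFrom v zero       x y = []
orbitFrom v (suc fuel) x y =
  if toℕ y ≡ᵇ toℕ x then [] else toℕ y ∷ orbitFrom v fuel x (lookup v y)

orbit : {m : ℕ} → Vec (Fin m) m → Fin m → List ℕ
orbit {m} v x = toℕ x ∷ orbitFrom v m x (lookup v x)

rotate : List ℕ → List ℕ
rotate []       = []
rotate (x ∷ xs) = xs ++ (x ∷ [])

cycPairs : List ℕ → List (ℕ × ℕ)
cycPairs c = zip c (rotate c)

cA : List ℕ → ℕ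
cA c = countTrue (λ p → proj₁ p ≤ᵇ proj₂ p) (cycPairs c)

cD : List ℕ → ℕ
cD c = countTrue (λ p → proj₂ p <ᵇ proj₁ p) (cycPairs c)

Mc : List ℕ → ℕ
Mc c = cA c ⊓ cD c

-- x is the least element of its cycle (each cycle is counted once,
-- through its least element)
isCycleMin : {m : ℕ} → Vec (Fin m) m → Fin m → Bool
isCycleMin v x = all (λ y → toℕ x ≤ᵇ y) (orbit v x)

Mperm : {m : ℕ} → Vec (Fin m) m → ℕ
Mperm {m} v = sum (map (λ x → if isCycleMin v x then Mc (orbit v x) else 0) (allFin m))

odd : ℕ → Bool
odd zero          = false
odd (suc zero)    = true
odd (suc (suc k)) = odd k

allCyclesOdd : {m : ℕ} → Vec (Fin m) m → Bool
allCyclesOdd {m} v = all (λ x → odd (length (orbit v x))) (allFin m)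

inP : (m d : ℕ) → Vec (Fin m) m → Bool
inP m d v = isPerm v ∧ allCyclesOdd v ∧ (Mperm v ≡ᵇ d)

p : ℕ → ℕ → ℕ
p m d = countTrue (inP m d) (allVecs m m)

P : ℕ → ℕ → Set
P m d = Σ (Vec (Fin m) m) (λ v → T (inP m d v))

{-# OPTIONS --safe #-}
module Submission where

-- Both sets are identified with the circular arrangements of [2n+1] having n or n+1 cyclic descents.
--
-- Ballot permutations: reversal preserves B(2n+1,n) and exchanges the two directions of the closing
-- step from the last entry back to the first.  If that step descends, the cyclic word of ascents and
-- descents has n+1 descents and n ascents, and by the cycle lemma exactly one rotation of a circular
-- arrangement with that many descents is ballot: start at the first minimum of the height function.
--
-- Odd-cycle permutations: an odd cycle c satisfies 2 M(c) + 1 ≤ |c|, so M(π) = n on [2n+1] forces π to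
-- be a single cycle, that is, a circular arrangement.
--
-- Cutting a circular arrangement at its least entry leaves a permutation of [2n] with one cyclic
-- descent fewer, and reversal exchanges n and n-1 descents; hence the factor 2 in EC(n) = 2 E(2n,n-1).

open import Defs
open import Data.Bool using (Bool; true; false; not; if_then_else_; T; _∧_)
open import Data.Bool.ListAction using (any)
open import Data.Bool.Properties using (T?; T-irrelevant; T-∧; T-≡)
open import Data.Nat
open import Data.Nat.ListAction using (sum)
open import Data.Nat.Properties
open import Data.Nat.Solver using (module +-*-Solver)
open import Data.Fin using (Fin; zero; suc; toℕ; fromℕ<)
open import Data.Fin.Permutation using (↔⇒≡)
open import Data.Fin.Properties using (toℕ-injective; toℕ<n; toℕ-fromℕ<; injective⇒≤; pigeonhole; *↔×; 2↔Bool)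
open import Data.List hiding (any; all; sum)
open import Data.List.Properties
open import Data.List.Membership.DecPropositional _≟_ using (_∈?_)
open import Data.List.Membership.Propositional using (_∈_)
open import Data.List.Membership.Propositional.Properties
open import Data.List.Relation.Binary.Disjoint.Propositional using (Disjoint)
open import Data.List.Relation.Binary.Permutation.Propositional using (_↭_; ↭-refl; ↭-sym; ↭-trans; ↭⇒↭ₛ)
open import Data.List.Relation.Binary.Permutation.Propositional.Properties using (All-resp-↭; ↭-length; ↭-reverse; ∷↭∷ʳ)
import Data.List.Relation.Binary.Permutation.Setoid.Properties as Permutationₛ
open import Data.List.Relation.Unary.All as All using (All; []; _∷_)
import Data.List.Relation.Unary.All.Properties as All
open import Data.List.Relation.Unary.AllPairs as AllPairs using ([]; _∷_)
import Data.List.Relation.Unary.AllPairs.Properties as AllPairs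
open import Data.List.Relation.Unary.Any as Any using (here; there)
open import Data.List.Relation.Unary.Any.Properties using (lookup-index)
open import Data.List.Relation.Unary.Unique.Propositional using (Unique)
import Data.List.Relation.Unary.Unique.Propositional.Properties as Unique
open import Data.Product using (Σ; ∃; ∃₂; _×_; _,_; proj₁; proj₂)
open import Data.Product.Function.NonDependent.Propositional using (_×-↔_)
open import Data.Sum as Sum using (_⊎_; inj₁; inj₂)
open import Data.Vec as Vec using (Vec; []; _∷_)
import Data.Vec.Properties as Vec
open import Function.Base using (_∘_; id)
open import Function.Bundles using (_↔_; mk↔ₛ′; Equivalence)
open import Function.Construct.Composition using (_↔-∘_)
open import Function.Construct.Symmetry using (↔-sym)
open import Function.Definitions using (Injective)
open import Relation.Binary.PropositionalEquality hiding ([_])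
open import Relation.Nullary using (Dec; yes; no; contradiction)

-- The two identifications meet in `Bool × A`: two copies of the permutations of [2n] with n-1
-- descents. On the ballot side the Boolean is the direction of the closing step; on the odd-cycle
-- side it tells n+1 cyclic descents from n. One chain of bijections per side thus yields both the
-- count and, by composing the chains, the bijection between the two sets.
--
-- The cycle count rests on a sum: adding 2 M(c) + 1 ≤ |c| over all cycles bounds 2 M(π) plus the
-- number of cycles by 2n+1, and M(π) = n leaves room for just one cycle.
--
-- The intermediate objects are plain lists of numbers with side conditions. The maps between them
-- are therefore total, with default values outside the intended domain, and the conditions enter
-- only in the laws of `≃`.
--
-- For n = 0 reversal fixes the only permutation, so nothing is doubled; this case is settled by
-- evaluation.

-- Bijections between subsets

∧⁻ : ∀ {x y} → T (x ∧ y) → T x × T y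
∧⁻ = Equivalence.to T-∧

∧⁺ : ∀ {x y} → T x → T y → T (x ∧ y)
∧⁺ p q = Equivalence.from T-∧ (p , q)

-- A bijection between two subsets, by maps that are total on the ambient types.
record _≃_ {A B : Set} (P : A → Set) (Q : B → Set) : Set where
  field
    to        : A → B
    from      : B → A
    to-pres   : ∀ {x} → P x → Q (to x)
    from-pres : ∀ {y} → Q y → P (from y)
    from-to   : ∀ {x} → P x → from (to x) ≡ x
    to-from   : ∀ {y} → Q y → to (from y) ≡ y

open _≃_

≃-sym : {A B : Set} {P : A → Set} {Q : B → Set} → P ≃ Q → Q ≃ P
≃-sym e = record
  { to = from e ; from = to e ; to-pres = from-pres e ; from-pres = to-pres e
  ; from-to = to-from e ; to-from = from-to e }

≃-trans : {A B C : Set} {P : A → Set} {Q : B → Set} {R : C → Set} → P ≃ Q → Q ≃ R → P ≃ R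
≃-trans e f = record
  { to        = to f ∘ to e
  ; from      = from e ∘ from f
  ; to-pres   = to-pres f ∘ to-pres e
  ; from-pres = from-pres e ∘ from-pres f
  ; from-to   = λ p → trans (cong (from e) (from-to f (to-pres e p))) (from-to e p)
  ; to-from   = λ r → trans (cong (to f) (to-from e (from-pres f r))) (to-from f r)
  }

-- The factor 2 of `EC` is carried as a Boolean coordinate, so that it survives the composition of
-- bijections and becomes a number only in `count-doubled`.
Doubled : {A : Set} → (A → Set) → Bool × A → Set
Doubled P (_ , x) = P x

Doubled-cong : {A B : Set} {P : A → Set} {Q : B → Set} → P ≃ Q → Doubled P ≃ Doubled Q
Doubled-cong e = record
  { to        = λ (s , x) → s , to e x
  ; from      = λ (s , y) → s , from e y
  ; to-pres   = to-pres e
  ; from-pres = from-pres e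
  ; from-to   = λ {(s , x)} p → cong (s ,_) (from-to e p)
  ; to-from   = λ {(s , y)} q → cong (s ,_) (to-from e q)
  }

≃-id : {A : Set} {P Q : A → Set} → (∀ {x} → P x → Q x) → (∀ {x} → Q x → P x) → P ≃ Q
≃-id f g = record
  { to = id ; from = id ; to-pres = f ; from-pres = g ; from-to = λ _ → refl ; to-from = λ _ → refl }

-- The Boolean records which of the two halves exchanged by the involution r the element came from.
involution-halves : {A : Set} {P Q : A → Set} (r : A → A) (s : A → Bool) → (∀ x → r (r x) ≡ x) →
  (∀ {x} → P x → s x ≡ false → Q x) → (∀ {x} → P x → s x ≡ true → Q (r x)) →
  (∀ {x} → Q x → P x × s x ≡ false) → (∀ {x} → Q x → P (r x) × s (r x) ≡ true) →
  P ≃ Doubled Q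
involution-halves {A} {P} {Q} r s rr low high low⁻ high⁻ = record
  { to        = λ x → s x , flip (s x) x
  ; from      = λ (t , x) → flip t x
  ; to-pres   = λ {x} → to-pres′ x
  ; from-pres = λ { {true , _} q → proj₁ (high⁻ q) ; {false , _} q → proj₁ (low⁻ q) }
  ; from-to   = λ {x} _ → flip-flip (s x) x
  ; to-from   = λ { {true  , x} q → to-flip true (proj₂ (high⁻ q))
                  ; {false , x} q → to-flip false (proj₂ (low⁻ q)) }
  }
  where
  flip : Bool → A → A
  flip t x = if t then r x else x

  flip-flip : ∀ t x → flip t (flip t x) ≡ x
  flip-flip true  x = rr x
  flip-flip false x = refl

  to-flip : ∀ t {x} → s (flip t x) ≡ t → (s (flip t x) , flip (s (flip t x)) (flip t x)) ≡ (t , x)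
  to-flip t {x} eq = cong₂ _,_ eq (trans (cong (λ t′ → flip t′ (flip t x)) eq) (flip-flip t x))

  to-pres′ : ∀ x → P x → Q (flip (s x) x)
  to-pres′ x p with s x in eq
  ... | true  = high p eq
  ... | false = low p eq

Σ-T-≡ : {A : Set} {p : A → Bool} {u w : Σ A (T ∘ p)} → proj₁ u ≡ proj₁ w → u ≡ w
Σ-T-≡ {u = x , s} {.x , t} refl = cong (x ,_) (T-irrelevant s t)

≃⇒↔ : {A B : Set} {p : A → Bool} {q : B → Bool} → (T ∘ p) ≃ (T ∘ q) → Σ A (T ∘ p) ↔ Σ B (T ∘ q)
≃⇒↔ e = mk↔ₛ′
  (λ (x , t) → to e x , to-pres e t)
  (λ (y , t) → from e y , from-pres e t)
  (λ (y , t) → Σ-T-≡ (to-from e t))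
  (λ (x , t) → Σ-T-≡ (from-to e t))

-- Counting a decidable subset by enumeration

lookup-injective : {A : Set} {xs : List A} → Unique xs →
                   ∀ {i j} → lookup xs i ≡ lookup xs j → i ≡ j
lookup-injective (_ ∷ _)  {zero}  {zero}  eq = refl
lookup-injective {xs = _ ∷ xs} (x∉ ∷ _)  {zero}  {suc j} eq =
  contradiction (subst (_∈ xs) (sym eq) (∈-lookup j)) (All.All¬⇒¬Any x∉)
lookup-injective {xs = _ ∷ xs} (x∉ ∷ _)  {suc i} {zero}  eq =
  contradiction (subst (_∈ xs) eq (∈-lookup i)) (All.All¬⇒¬Any x∉)
lookup-injective (_ ∷ u)  {suc i} {suc j} eq = cong suc (lookup-injective u eq)

countTrue≡length-filter : {A : Set} (p : A → Bool) (xs : List A) →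
                          countTrue p xs ≡ length (filter (T? ∘ p) xs)
countTrue≡length-filter p [] = refl
countTrue≡length-filter p (x ∷ xs) with p x
... | true  = cong suc (countTrue≡length-filter p xs)
... | false = countTrue≡length-filter p xs

module _ {A : Set} {xs : List A} (xs! : Unique xs) (x∈xs : ∀ x → x ∈ xs) (p : A → Bool) where

  private
    ys : List A
    ys = filter (T? ∘ p) xs

    ∈ys : (u : Σ A (T ∘ p)) → proj₁ u ∈ ys
    ∈ys (x , t) = ∈-filter⁺ (T? ∘ p) (x∈xs x) t

  -- An element is numbered by its position in the filtered enumeration: completeness of `xs`
  -- provides a position, and the absence of repetitions makes it the only one.
  Σ↔countTrue : Σ A (T ∘ p) ↔ Fin (countTrue p xs)
  Σ↔countTrue rewrite countTrue≡length-filter p xs = mk↔ₛ′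
    (λ u → Any.index (∈ys u))
    (λ i → lookup ys i , proj₂ (∈-filter⁻ (T? ∘ p) {xs = xs} (∈-lookup {xs = ys} i)))
    (λ i → lookup-injective (Unique.filter⁺ (T? ∘ p) xs!) (sym (lookup-index (∈ys _))))
    (λ u → Σ-T-≡ (sym (lookup-index (∈ys u))))

-- This exhibits the recursion of `allVecs` as a Cartesian product, whose uniqueness and membership
-- properties then carry over.
concatMap-map≡cartesianProductWith : {A B C : Set} (f : A → B → C) (xs : List A) (ys : List B) →
  concatMap (λ x → map (f x) ys) xs ≡ cartesianProductWith f xs ys
concatMap-map≡cartesianProductWith f []       ys = refl
concatMap-map≡cartesianProductWith f (x ∷ xs) ys =
  cong (map (f x) ys ++_) (concatMap-map≡cartesianProductWith f xs ys)

allVecs-unique : ∀ m k → Unique (allVecs m k)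
allVecs-unique m zero    = [] ∷ []
allVecs-unique m (suc k)
  rewrite concatMap-map≡cartesianProductWith (Vec._∷_ {n = k}) (allFin m) (allVecs m k) =
  Unique.cartesianProductWith⁺ Vec._∷_ Vec.∷-injective (Unique.allFin⁺ m) (allVecs-unique m k)

allVecs-complete : ∀ m k (v : Vec (Fin m) k) → v ∈ allVecs m k
allVecs-complete m zero    []      = here refl
allVecs-complete m (suc k) (i ∷ v)
  rewrite concatMap-map≡cartesianProductWith (Vec._∷_ {n = k}) (allFin m) (allVecs m k) =
  ∈-cartesianProductWith⁺ Vec._∷_ (∈-allFin i) (allVecs-complete m k v)

Σ↔count-allVecs : ∀ {m k} (p : Vec (Fin m) k → Bool) → Σ (Vec (Fin m) k) (T ∘ p) ↔ Fin (countTrue p (allVecs m k))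
Σ↔count-allVecs {m} {k} = Σ↔countTrue (allVecs-unique m k) (allVecs-complete m k)

Doubled↔ : {A : Set} {p : A → Bool} → Σ (Bool × A) (T ∘ p ∘ proj₂) ↔ (Bool × Σ A (T ∘ p))
Doubled↔ = mk↔ₛ′ (λ ((s , x) , t) → s , x , t) (λ (s , x , t) → (s , x) , t) (λ _ → refl) (λ _ → refl)

-- Both sides are turned into `Fin` types, with `Bool` read as `Fin 2`; a bijection between finite
-- ordinals forces them to be equal.
count-doubled : ∀ {m k} {p : Vec (Fin m) m → Bool} {q : Vec (Fin k) k → Bool} →
                (T ∘ p) ≃ Doubled (T ∘ q) → countTrue p (allVecs m m) ≡ 2 * countTrue q (allVecs k k)
count-doubled {p = p} {q} e = ↔⇒≡
  (↔-sym *↔× ↔-∘ ((↔-sym 2↔Bool ×-↔ Σ↔count-allVecs q) ↔-∘ (Doubled↔ ↔-∘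
    (≃⇒↔ {p = p} {q = q ∘ proj₂} e ↔-∘ ↔-sym (Σ↔count-allVecs p)))))

-- Permutations as lists of numbers

record IsPermList (m : ℕ) (l : List ℕ) : Set where
  constructor mkPerm
  field
    length≡ : length l ≡ m
    unique  : Unique l
    bounded : All (_< m) l

open IsPermList

-- Junk value: nth l i = 0 for i ≥ length l.
nth : List ℕ → ℕ → ℕ
nth []       _       = 0
nth (x ∷ xs) zero    = x
nth (x ∷ xs) (suc i) = nth xs i

-- Junk value: index y l = length l for y ∉ l.
index : ℕ → List ℕ → ℕ
index y []       = 0
index y (x ∷ xs) with x ≟ y
... | yes _ = 0
... | no  _ = suc (index y xs)

nth-ext : ∀ {xs ys} → length xs ≡ length ys → (∀ {i} → i < length xs → nth xs i ≡ nth ys i) → xs ≡ ys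
nth-ext {[]}     {[]}     _  _ = refl
nth-ext {x ∷ xs} {y ∷ ys} eq h =
  cong₂ _∷_ (h z<s) (nth-ext (suc-injective eq) (λ i< → h (s<s i<)))

nth-∈ : ∀ {l i} → i < length l → nth l i ∈ l
nth-∈ {x ∷ l} {zero}  _   = here refl
nth-∈ {x ∷ l} {suc i} i<l = there (nth-∈ (s<s⁻¹ i<l))

nth-overflow : ∀ l → nth l (length l) ≡ 0
nth-overflow []      = refl
nth-overflow (x ∷ l) = nth-overflow l

nth-injective : ∀ {l} → Unique l → ∀ {i j} → i < length l → j < length l → nth l i ≡ nth l j → i ≡ j
nth-injective (_  ∷ _) {zero}  {zero}  _  _  _  = refl
nth-injective {_ ∷ l} (x∉ ∷ _) {zero}  {suc j} _  j< eq =
  contradiction (subst (_∈ l) (sym eq) (nth-∈ (s<s⁻¹ j<))) (All.All¬⇒¬Any x∉)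
nth-injective {_ ∷ l} (x∉ ∷ _) {suc i} {zero}  i< _  eq =
  contradiction (subst (_∈ l) eq (nth-∈ (s<s⁻¹ i<))) (All.All¬⇒¬Any x∉)
nth-injective (_ ∷ u)  {suc i} {suc j} i< j< eq =
  cong suc (nth-injective u (s<s⁻¹ i<) (s<s⁻¹ j<) eq)

index-∈ : ∀ {y l} → y ∈ l → index y l < length l × nth l (index y l) ≡ y
index-∈ {y} {x ∷ l} y∈ with x ≟ y
... | yes x≡y = z<s , x≡y
index-∈ {y} {x ∷ l} (here y≡x) | no x≢y = contradiction (sym y≡x) x≢y
index-∈ {y} {x ∷ l} (there y∈) | no x≢y = let i< , eq = index-∈ y∈ in s<s i< , eq

index-nth : ∀ {l} → Unique l → ∀ {i} → i < length l → index (nth l i) l ≡ i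
index-nth {l} l! i< = let j< , eq = index-∈ (nth-∈ {l} i<) in nth-injective l! j< i< eq

unique-bounded⇒length≤ : ∀ {m l} → Unique l → All (_< m) l → length l ≤ m
unique-bounded⇒length≤ {m} {l} l! l< = injective⇒≤ {f = f} f-injective
  where
  bnd : ∀ i → lookup l i < m
  bnd i = All.lookup l< (∈-lookup i)

  f : Fin (length l) → Fin m
  f i = fromℕ< (bnd i)

  f-injective : ∀ {i j} → f i ≡ f j → i ≡ j
  f-injective {i} {j} eq = lookup-injective l!
    (trans (sym (toℕ-fromℕ< (bnd i))) (trans (cong toℕ eq) (toℕ-fromℕ< (bnd j))))

-- A missing value could be prepended, giving `m + 1` distinct numbers below `m`.
perm-∈ : ∀ {m l y} → IsPermList m l → y < m → y ∈ l
perm-∈ {m} {l} {y} π y<m with y ∈? l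
... | yes y∈l = y∈l
... | no  y∉l = contradiction
  (unique-bounded⇒length≤ (All.¬Any⇒All¬ l y∉l ∷ unique π) (y<m ∷ bounded π))
  (<⇒≱ (s≤s (≤-reflexive (sym (length≡ π)))))

distinct⇒Unique : ∀ l → T (distinct l) → Unique l
distinct⇒Unique []      _ = []
distinct⇒Unique (x ∷ l) t = x∉ l (proj₁ (∧⁻ t)) ∷ distinct⇒Unique l (proj₂ (∧⁻ {not (any _ l)} t))
  where
  x∉ : ∀ l → T (not (any (x ≡ᵇ_) l)) → All (x ≢_) l
  x∉ []      _ = []
  x∉ (y ∷ l) t with x ≡ᵇ y in eq
  ... | false = (λ x≡y → subst T eq (≡⇒≡ᵇ x y x≡y)) ∷ x∉ l t

Unique⇒distinct : ∀ {l} → Unique l → T (distinct l)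
Unique⇒distinct []              = _
Unique⇒distinct (_∷_ {x} x∉ l!) = ∧⁺ (t x∉) (Unique⇒distinct l!)
  where
  t : ∀ {l} → All (x ≢_) l → T (not (any (x ≡ᵇ_) l))
  t []                 = _
  t (_∷_ {y} x≢y x∉) with x ≡ᵇ y in eq
  ... | true  = contradiction (≡ᵇ⇒≡ x y (subst T (sym eq) _)) x≢y
  ... | false = t x∉

length-oneLine : ∀ {m} (v : Vec (Fin m) m) → length (oneLine v) ≡ m
length-oneLine v = Vec.length-toList (Vec.map toℕ v)

oneLine-bounded : ∀ {m k} (v : Vec (Fin m) k) → All (_< m) (Vec.toList (Vec.map toℕ v))
oneLine-bounded []      = []
oneLine-bounded (i ∷ v) = toℕ<n i ∷ oneLine-bounded v

nth-toList : ∀ {m k} (v : Vec (Fin m) k) i → nth (Vec.toList (Vec.map toℕ v)) (toℕ i) ≡ toℕ (Vec.lookup v i)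
nth-toList (x ∷ v) zero    = refl
nth-toList (x ∷ v) (suc i) = nth-toList v i

isPerm⇒IsPermList : ∀ {m} {v : Vec (Fin m) m} → T (isPerm v) → IsPermList m (oneLine v)
isPerm⇒IsPermList {v = v} t = mkPerm (length-oneLine v) (distinct⇒Unique _ t) (oneLine-bounded v)

-- Junk value: clamp x = 0 for x out of range.
clamp : ∀ {m} → ℕ → Fin (suc m)
clamp {m} x with x <? suc m
... | yes x<m = fromℕ< x<m
... | no  _   = zero

toℕ-clamp : ∀ {m x} → x < suc m → toℕ (clamp {m} x) ≡ x
toℕ-clamp {m} {x} x<m with x <? suc m
... | yes p   = toℕ-fromℕ< p
... | no  x≮m = contradiction x<m x≮m

clamp-toℕ : ∀ {m} (i : Fin (suc m)) → clamp (toℕ i) ≡ i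
clamp-toℕ i = toℕ-injective (toℕ-clamp (toℕ<n i))

-- Clamping makes this total in `f`, as the inverse maps of `≃` must be defined on arbitrary lists.
tabulateℕ : ∀ {m} → (ℕ → ℕ) → Vec (Fin (suc m)) (suc m)
tabulateℕ f = Vec.tabulate (λ i → clamp (f (toℕ i)))

toℕ-lookup-tabulateℕ : ∀ {m} (f : ℕ → ℕ) (i : Fin (suc m)) → f (toℕ i) < suc m →
                       toℕ (Vec.lookup (tabulateℕ f) i) ≡ f (toℕ i)
toℕ-lookup-tabulateℕ f i f< = trans (cong toℕ (Vec.lookup∘tabulate (λ j → clamp (f (toℕ j))) i)) (toℕ-clamp f<)

tabulateℕ-lookup : ∀ {m} (f : ℕ → ℕ) (v : Vec (Fin (suc m)) (suc m)) →
                   (∀ i → f (toℕ i) ≡ toℕ (Vec.lookup v i)) → tabulateℕ f ≡ v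
tabulateℕ-lookup f v eq = trans
  (Vec.tabulate-cong {g = Vec.lookup v} (λ i → trans (cong clamp (eq i)) (clamp-toℕ (Vec.lookup v i))))
  (Vec.tabulate∘lookup v)

nth-oneLine-tabulateℕ : ∀ {m} (f : ℕ → ℕ) {i} → i < suc m → f i < suc m → nth (oneLine (tabulateℕ {m} f)) i ≡ f i
nth-oneLine-tabulateℕ {m} f {i} i< f< = begin
  nth (oneLine v) i                     ≡⟨ cong (nth (oneLine v)) (sym (toℕ-fromℕ< i<)) ⟩
  nth (oneLine v) (toℕ (fromℕ< i<))     ≡⟨ nth-toList v (fromℕ< i<) ⟩
  toℕ (Vec.lookup v (fromℕ< i<))        ≡⟨ toℕ-lookup-tabulateℕ f _ f<′ ⟩
  f (toℕ (fromℕ< i<))                   ≡⟨ cong f (toℕ-fromℕ< i<) ⟩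
  f i                                   ∎
  where
  open ≡-Reasoning
  v = tabulateℕ {m} f

  f<′ : f (toℕ (fromℕ< i<)) < suc m
  f<′ = subst (λ j → f j < suc m) (sym (toℕ-fromℕ< i<)) f<

perm-nth< : ∀ {m l i} → IsPermList m l → i < m → nth l i < m
perm-nth< π i< = All.lookup (bounded π) (nth-∈ (<-≤-trans i< (≤-reflexive (sym (length≡ π)))))

oneLine-tabulateℕ-nth : ∀ {m l} → IsPermList (suc m) l → oneLine (tabulateℕ {m} (nth l)) ≡ l
oneLine-tabulateℕ-nth {m} {l} π = nth-ext (trans (length-oneLine v) (sym (length≡ π)))
  (λ i< → let i<m = <-≤-trans i< (≤-reflexive (length-oneLine v)) in
    nth-oneLine-tabulateℕ (nth l) i<m (perm-nth< π i<m))
  where v = tabulateℕ {m} (nth l)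

-- The combinatorics takes place on lists, where reversal, rotation and deletion involve no type
-- index. `Q` is the further condition on the one-line notation, instantiated once for ballot
-- permutations and once for descent numbers.
isPerm≃IsPermList : ∀ {m} (Q : List ℕ → Set) →
  (λ (v : Vec (Fin (suc m)) (suc m)) → T (isPerm v) × Q (oneLine v)) ≃ (λ l → IsPermList (suc m) l × Q l)
isPerm≃IsPermList {m} Q = record
  { to        = oneLine
  ; from      = λ l → tabulateℕ (nth l)
  ; to-pres   = λ {v} (t , q) → isPerm⇒IsPermList {v = v} t , q
  ; from-pres = λ (π , q) → let eq = sym (oneLine-tabulateℕ-nth π) in
      subst (T ∘ distinct) eq (Unique⇒distinct (unique π)) , subst Q eq q
  ; from-to   = λ {v} _ → tabulateℕ-lookup (nth (oneLine v)) v (nth-toList v)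
  ; to-from   = λ (π , _) → oneLine-tabulateℕ-nth π
  }

-- Words of ups and downs

countTrue-++ : {A : Set} (p : A → Bool) (xs ys : List A) →
               countTrue p (xs ++ ys) ≡ countTrue p xs + countTrue p ys
countTrue-++ p []       ys = refl
countTrue-++ p (x ∷ xs) ys with p x
... | true  = cong suc (countTrue-++ p xs ys)
... | false = countTrue-++ p xs ys

countTrue-comm : {A : Set} (p : A → Bool) (xs ys : List A) →
                 countTrue p (xs ++ ys) ≡ countTrue p (ys ++ xs)
countTrue-comm p xs ys = trans (countTrue-++ p xs ys)
  (trans (+-comm (countTrue p xs) _) (sym (countTrue-++ p ys xs)))

countTrue-reverse : {A : Set} (p : A → Bool) (xs : List A) → countTrue p (reverse xs) ≡ countTrue p xs
countTrue-reverse p []       = refl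
countTrue-reverse p (x ∷ xs) = begin
  countTrue p (reverse (x ∷ xs))         ≡⟨ cong (countTrue p) (unfold-reverse x xs) ⟩
  countTrue p (reverse xs ++ [ x ])      ≡⟨ countTrue-comm p (reverse xs) [ x ] ⟩
  countTrue p ([ x ] ++ reverse xs)      ≡⟨ countTrue-++ p [ x ] (reverse xs) ⟩
  countTrue p [ x ] + countTrue p (reverse xs) ≡⟨ cong (countTrue p [ x ] +_) (countTrue-reverse p xs) ⟩
  countTrue p [ x ] + countTrue p xs     ≡⟨ sym (countTrue-++ p [ x ] xs) ⟩
  countTrue p (x ∷ xs)                   ∎
  where open ≡-Reasoning

ups downs : List Bool → ℕ
ups   = countTrue id
downs = countTrue not

ups-not : ∀ s → ups (map not s) ≡ downs s
ups-not []          = refl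
ups-not (true ∷ s)  = ups-not s
ups-not (false ∷ s) = cong suc (ups-not s)

downs-not : ∀ s → downs (map not s) ≡ ups s
downs-not []          = refl
downs-not (true ∷ s)  = cong suc (downs-not s)
downs-not (false ∷ s) = downs-not s

ups+downs : ∀ s → ups s + downs s ≡ length s
ups+downs []          = refl
ups+downs (true ∷ s)  = cong suc (ups+downs s)
ups+downs (false ∷ s) = trans (+-suc (ups s) (downs s)) (cong suc (ups+downs s))

Ballot : List Bool → Set
Ballot s = ∀ u v → s ≡ u ++ v → downs u ≤ ups u

-- The whole word is exempt: a cyclic word with `n + 1` descents and `n` ascents ends below its
-- starting height.
ProperBallot : List Bool → Set
ProperBallot s = ∀ u v → s ≡ u ++ v → v ≢ [] → downs u ≤ ups u

++-split : {A : Set} (xs : List A) {ys u v : List A} → xs ++ ys ≡ u ++ v →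
           (∃ λ z → xs ≡ u ++ z × v ≡ z ++ ys) ⊎ (∃ λ z → u ≡ xs ++ z × ys ≡ z ++ v)
++-split []       {u = u}     eq = inj₂ (u , refl , eq)
++-split (x ∷ xs) {u = []}    eq = inj₁ (x ∷ xs , refl , sym eq)
++-split (x ∷ xs) {u = y ∷ u} eq with ∷-injective eq
... | refl , eq′ with ++-split xs eq′
...   | inj₁ (z , p , q) = inj₁ (z , cong (x ∷_) p , q)
...   | inj₂ (z , p , q) = inj₂ (z , cong (x ∷_) p , q)

∷ʳ≢[] : {A : Set} (xs : List A) {x : A} → xs ∷ʳ x ≢ []
∷ʳ≢[] []       ()
∷ʳ≢[] (_ ∷ _) ()

-- The proper prefixes of `s ∷ʳ b` are exactly the prefixes of `s`.
Ballot⇒ProperBallot-∷ʳ : ∀ {s b} → Ballot s → ProperBallot (s ∷ʳ b)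
Ballot⇒ProperBallot-∷ʳ {s} β u v eq v≢[] with ++-split s eq
... | inj₁ (z , s≡ , _)        = β u z s≡
... | inj₂ ([]    , u≡ , _)    = β u [] (trans (sym (trans u≡ (++-identityʳ s))) (sym (++-identityʳ u)))
... | inj₂ (x ∷ [] , _ , b≡)   = contradiction (sym (proj₂ (∷-injective b≡))) v≢[]

ProperBallot-∷ʳ⇒Ballot : ∀ {s b} → ProperBallot (s ∷ʳ b) → Ballot s
ProperBallot-∷ʳ⇒Ballot {b = b} β u v eq =
  β u (v ∷ʳ b) (trans (cong (_∷ʳ b) eq) (++-assoc u v [ b ])) (∷ʳ≢[] v)

-- The new word walks the same path backwards, and the path ends at height 0. A prefix `u` of it is
-- the suffix `u′` of `s` turned round, so its height is that of the complementary prefix `v′` of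
-- `s`, which is not negative.
Ballot-reverse : ∀ {s} → Ballot s → downs s ≡ ups s → Ballot (reverse (map not s))
Ballot-reverse {s} β bal u v eq = +-cancelʳ-≤ (ups v′) _ _ (begin
  downs u + ups v′       ≡⟨ cong (_+ ups v′) (sym downs-u) ⟩
  ups u′ + ups v′        ≡⟨ +-comm (ups u′) _ ⟩
  ups v′ + ups u′        ≡⟨ sym (countTrue-++ id v′ u′) ⟩
  ups (v′ ++ u′)         ≡⟨ cong ups (sym s≡) ⟩
  ups s                  ≡⟨ sym bal ⟩
  downs s                ≡⟨ cong downs s≡ ⟩
  downs (v′ ++ u′)       ≡⟨ countTrue-++ not v′ u′ ⟩
  downs v′ + downs u′    ≤⟨ +-monoˡ-≤ _ (β v′ u′ s≡) ⟩
  ups v′ + downs u′      ≡⟨ cong (ups v′ +_) (trans (downs-not (reverse u)) (countTrue-reverse id u)) ⟩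
  ups v′ + ups u         ≡⟨ +-comm (ups v′) _ ⟩
  ups u + ups v′         ∎)
  where
  open ≤-Reasoning
  u′ = map not (reverse u)
  v′ = map not (reverse v)

  downs-u : ups u′ ≡ downs u
  downs-u = trans (ups-not (reverse u)) (countTrue-reverse not u)

  not-not : ∀ t → map not (map not t) ≡ t
  not-not []          = refl
  not-not (true ∷ t)  = cong (true ∷_) (not-not t)
  not-not (false ∷ t) = cong (false ∷_) (not-not t)

  s≡ : s ≡ v′ ++ u′
  s≡ = trans (sym (not-not s)) (trans
    (cong (map not) (trans (sym (reverse-involutive (map not s))) (trans (cong reverse eq) (reverse-++ u v))))
    (map-++ not (reverse v) (reverse u)))

-- Rotations and the cycle lemma

rot₁ : {A : Set} → List A → List A
rot₁ []       = []
rot₁ (x ∷ xs) = xs ∷ʳ x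

rot : {A : Set} → ℕ → List A → List A
rot zero    l = l
rot (suc k) l = rot₁ (rot k l)

module _ {A : Set} where

  rot-rot₁ : ∀ k (l : List A) → rot k (rot₁ l) ≡ rot₁ (rot k l)
  rot-rot₁ zero    l = refl
  rot-rot₁ (suc k) l = cong rot₁ (rot-rot₁ k l)

  rot-rot : ∀ j k (l : List A) → rot j (rot k l) ≡ rot (j + k) l
  rot-rot zero    k l = refl
  rot-rot (suc j) k l = cong rot₁ (rot-rot j k l)

  rot-++ : ∀ (xs ys : List A) → rot (length xs) (xs ++ ys) ≡ ys ++ xs
  rot-++ []       ys = sym (++-identityʳ ys)
  rot-++ (x ∷ xs) ys = begin
    rot₁ (rot (length xs) (x ∷ xs ++ ys)) ≡⟨ sym (rot-rot₁ (length xs) _) ⟩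
    rot (length xs) ((xs ++ ys) ∷ʳ x)     ≡⟨ cong (rot (length xs)) (++-assoc xs ys [ x ]) ⟩
    rot (length xs) (xs ++ ys ∷ʳ x)       ≡⟨ rot-++ xs (ys ∷ʳ x) ⟩
    (ys ∷ʳ x) ++ xs                       ≡⟨ ++-assoc ys [ x ] xs ⟩
    ys ++ x ∷ xs                          ∎
    where open ≡-Reasoning

  rot-length : ∀ (l : List A) → rot (length l) l ≡ l
  rot-length l = trans (cong (rot (length l)) (sym (++-identityʳ l))) (rot-++ l [])

  rot₁-↭ : ∀ (l : List A) → rot₁ l ↭ l
  rot₁-↭ []      = ↭-refl
  rot₁-↭ (x ∷ l) = ↭-sym (∷↭∷ʳ x l)

  rot-↭ : ∀ k (l : List A) → rot k l ↭ l
  rot-↭ zero    l = ↭-refl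
  rot-↭ (suc k) l = ↭-trans (rot₁-↭ (rot k l)) (rot-↭ k l)

  rot-reduce : ∀ j {l : List A} → 0 < length l → ∃ λ i → i < length l × rot j l ≡ rot i l
  rot-reduce zero    0<l = 0 , 0<l , refl
  rot-reduce (suc j) {l} 0<l with rot-reduce j 0<l
  ... | i , i<l , eq with suc i <? length l
  ...   | yes i+1<l = suc i , i+1<l , cong rot₁ eq
  ...   | no  i+1≮l = 0 , 0<l , trans (cong rot₁ eq)
    (trans (cong (λ k → rot k l) (≤-antisym i<l (≮⇒≥ i+1≮l))) (rot-length l))

  split-at : ∀ i {l : List A} → i < length l → ∃₂ λ u a → ∃ λ v → l ≡ u ++ a ∷ v × length u ≡ i
  split-at zero    {x ∷ l} _  = [] , x , l , refl , refl
  split-at (suc i) {x ∷ l} i< with split-at i (s<s⁻¹ i<)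
  ... | u , a , v , eq , len = x ∷ u , a , v , cong (x ∷_) eq , cong suc len

IsPermList-resp-↭ : ∀ {m l l′} → l′ ↭ l → IsPermList m l → IsPermList m l′
IsPermList-resp-↭ p π = mkPerm (trans (↭-length p) (length≡ π))
  (Permutationₛ.Unique-resp-↭ (setoid ℕ) (↭⇒↭ₛ (↭-sym p)) (unique π)) (All-resp-↭ (↭-sym p) (bounded π))

-- Says by counting letters that the cut is the leftmost point of minimal height: by `after-≥0` no
-- later point is lower, and by `before-<0` every earlier point is strictly higher.
record FirstMinimum (s : List Bool) : Set where
  field
    before after : List Bool
    splits       : s ≡ before ++ after
    after-≥0     : Ballot after
    before-<0    : ∀ u v → before ≡ u ++ v → v ≢ [] → ups v < downs v

open FirstMinimum

-- Prepending `a` adds one point at the left of the path. This point becomes the first minimum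
-- unless the path falls strictly from it to the old one, that is, unless `a ∷ before` has more
-- downs than ups.
firstMinimum : ∀ s → FirstMinimum s
firstMinimum [] = record
  { before = [] ; after = [] ; splits = refl
  ; after-≥0 = λ { [] _ _ → z≤n } ; before-<0 = λ { [] _ eq v≢[] → contradiction (sym eq) v≢[] } }
firstMinimum (a ∷ s) with firstMinimum s
... | M with ups (a ∷ before M) <? downs (a ∷ before M)
...   | yes neg = record
  { before = a ∷ before M ; after = after M ; splits = cong (a ∷_) (splits M)
  ; after-≥0 = after-≥0 M
  ; before-<0 = λ { [] v eq _ → subst (λ w → ups w < downs w) eq neg
                  ; (x ∷ u) v eq v≢[] → before-<0 M u v (proj₂ (∷-injective eq)) v≢[] } }
...   | no ¬neg = record
  { before = [] ; after = a ∷ s ; splits = refl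
  ; after-≥0 = ballot′
  ; before-<0 = λ { [] _ eq v≢[] → contradiction (sym eq) v≢[] } }
  where
  open ≤-Reasoning
  pos : downs (a ∷ before M) ≤ ups (a ∷ before M)
  pos = ≮⇒≥ ¬neg

  ballot′ : Ballot (a ∷ s)
  ballot′ u v eq with ++-split (a ∷ before M) (trans (cong (a ∷_) (sym (splits M))) eq)
  ... | inj₂ (z , u≡ , after≡) = begin
    downs u                            ≡⟨ trans (cong downs u≡) (countTrue-++ not (a ∷ before M) z) ⟩
    downs (a ∷ before M) + downs z     ≤⟨ +-mono-≤ pos (after-≥0 M z v after≡) ⟩
    ups (a ∷ before M) + ups z         ≡⟨ sym (trans (cong ups u≡) (countTrue-++ id (a ∷ before M) z)) ⟩
    ups u                              ∎
  ... | inj₁ ([] , u≡ , _) = subst (λ w → downs w ≤ ups w) (trans u≡ (++-identityʳ u)) pos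
  ballot′ [] v eq | inj₁ (z@(_ ∷ _) , before≡ , _) = z≤n
  ballot′ (_ ∷ u) v eq | inj₁ (z@(_ ∷ _) , before≡ , _) with ∷-injective before≡
  -- The prefix stops short of the old minimum. All of `a ∷ before` does not fall, whereas the
  -- remaining `z` does, so the part read so far cannot have fallen.
  ... | refl , before≡′ = +-cancelʳ-≤ (downs z) _ _ (begin
    downs (a ∷ u) + downs z   ≡⟨ sym (countTrue-++ not (a ∷ u) z) ⟩
    downs (a ∷ u ++ z)        ≡⟨ cong downs (sym before≡) ⟩
    downs (a ∷ before M)      ≤⟨ pos ⟩
    ups (a ∷ before M)        ≡⟨ cong ups before≡ ⟩
    ups (a ∷ u ++ z)          ≡⟨ countTrue-++ id (a ∷ u) z ⟩
    ups (a ∷ u) + ups z       ≤⟨ +-monoʳ-≤ _ (<⇒≤ (before-<0 M u z before≡′ λ ())) ⟩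
    ups (a ∷ u) + downs z     ∎)

-- A proper prefix that wraps around leaves out a nonempty suffix `v` of `before`, which falls by at
-- least 1. The whole word falls by exactly 1, so the prefix does not fall.
rot-firstMinimum-ballot : ∀ {s} (M : FirstMinimum s) → downs s ≡ suc (ups s) →
                          ProperBallot (rot (length (before M)) s)
rot-firstMinimum-ballot {s} M tot u v eq v≢[]
  with ++-split (after M)
         (trans (sym (trans (cong (rot (length (before M))) (splits M)) (rot-++ (before M) (after M)))) eq)
... | inj₁ (z , after≡ , _) = after-≥0 M u z after≡
... | inj₂ (z , refl , before≡) = begin
    downs (ys ++ z)           ≤⟨ +-cancelˡ-≤ (suc (ups v)) _ _ lem ⟩
    ups (ys ++ z)             ∎
  where
  open ≤-Reasoning
  ys = after M
  regroup : (p : Bool → Bool) → countTrue p s ≡ countTrue p v + countTrue p (ys ++ z)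
  regroup p = begin-equality
    countTrue p s                                ≡⟨ cong (countTrue p) (splits M) ⟩
    countTrue p (before M ++ ys)                 ≡⟨ cong (λ w → countTrue p (w ++ ys)) before≡ ⟩
    countTrue p ((z ++ v) ++ ys)                 ≡⟨ countTrue-comm p (z ++ v) ys ⟩
    countTrue p (ys ++ z ++ v)                   ≡⟨ cong (countTrue p) (sym (++-assoc ys z v)) ⟩
    countTrue p ((ys ++ z) ++ v)                 ≡⟨ countTrue-comm p (ys ++ z) v ⟩
    countTrue p (v ++ (ys ++ z))                 ≡⟨ countTrue-++ p v (ys ++ z) ⟩
    countTrue p v + countTrue p (ys ++ z)        ∎
  lem : suc (ups v) + downs (ys ++ z) ≤ suc (ups v) + ups (ys ++ z)
  lem = begin
    suc (ups v) + downs (ys ++ z)   ≤⟨ +-monoˡ-≤ _ (before-<0 M z v before≡ v≢[]) ⟩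
    downs v + downs (ys ++ z)       ≡⟨ sym (regroup not) ⟩
    downs s                         ≡⟨ tot ⟩
    suc (ups s)                     ≡⟨ cong suc (regroup id) ⟩
    suc (ups v) + ups (ys ++ z)     ∎

-- A nontrivial rotation cuts `s` into two nonempty pieces, each a proper prefix of one of the two
-- ballot words. Neither piece falls, yet together they would have to fall by 1.
ballot-rotation-unique : ∀ {s i} → downs s ≡ suc (ups s) → ProperBallot s → ProperBallot (rot i s) →
                         i < length s → i ≡ 0
ballot-rotation-unique {s} {i} tot β β′ i< with split-at i {s} i<
... | [] , a , v , eq , refl = refl
... | u@(_ ∷ _) , a , v , refl , refl = contradiction
  (begin
    downs (u ++ a ∷ v)              ≡⟨ countTrue-++ not u (a ∷ v) ⟩
    downs u + downs (a ∷ v)         ≤⟨ +-mono-≤ (β u (a ∷ v) refl λ ()) (β′ (a ∷ v) u (rot-++ u (a ∷ v)) λ ()) ⟩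
    ups u + ups (a ∷ v)             ≡⟨ sym (countTrue-++ id u (a ∷ v)) ⟩
    ups (u ++ a ∷ v)                ∎)
  (<⇒≱ (≤-reflexive (sym tot)))
  where open ≤-Reasoning

-- The ascent-descent word of a list

σ : List ℕ → List Bool
σ (x ∷ y ∷ l) = (x <ᵇ y) ∷ σ (y ∷ l)
σ _           = []

<ᵇ-flip : ∀ {x y} → x ≢ y → (y <ᵇ x) ≡ not (x <ᵇ y)
<ᵇ-flip {zero}  {zero}  x≢y = contradiction refl x≢y
<ᵇ-flip {zero}  {suc y} x≢y = refl
<ᵇ-flip {suc x} {zero}  x≢y = refl
<ᵇ-flip {suc x} {suc y} x≢y = <ᵇ-flip {x} {y} (x≢y ∘ cong suc)

asc≡ups : ∀ l → asc l ≡ ups (σ l)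
asc≡ups []          = refl
asc≡ups (x ∷ [])    = refl
asc≡ups (x ∷ y ∷ l) with x <ᵇ y | asc≡ups (y ∷ l)
... | true  | eq = cong suc eq
... | false | eq = eq

-- A tie is a down for `σ` but no descent for `des`, hence the distinct entries.
des≡downs : ∀ {l} → Unique l → des l ≡ downs (σ l)
des≡downs []               = refl
des≡downs (_ ∷ [])         = refl
des≡downs {x ∷ y ∷ l} ((x≢y ∷ _) ∷ l!) rewrite <ᵇ-flip x≢y with x <ᵇ y
... | true  = des≡downs l!
... | false = cong suc (des≡downs l!)

length-σ : ∀ x l → length (σ (x ∷ l)) ≡ length l
length-σ x []      = refl
length-σ x (y ∷ l) = cong suc (length-σ y l)

σ-take : ∀ x l i → σ (take (suc i) (x ∷ l)) ≡ take i (σ (x ∷ l))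
σ-take x []      zero    = refl
σ-take x []      (suc i) = refl
σ-take x (y ∷ l) zero    = refl
σ-take x (y ∷ l) (suc i) = cong ((x <ᵇ y) ∷_) (σ-take y l i)

take-length-++ : {A : Set} (u v : List A) → take (length u) (u ++ v) ≡ u
take-length-++ []      v = refl
take-length-++ (x ∷ u) v = cong (x ∷_) (take-length-++ u v)

PrefixBallot : List ℕ → ℕ → Set
PrefixBallot l j = T (des (take j l) ≤ᵇ asc (take j l))

prefixBallot⇒ : ∀ {l j} → Unique l → PrefixBallot l j → downs (σ (take j l)) ≤ ups (σ (take j l))
prefixBallot⇒ {l} {j} l! t =
  subst₂ _≤_ (des≡downs (Unique.take⁺ j l!)) (asc≡ups (take j l)) (≤ᵇ⇒≤ _ _ t)

⇒prefixBallot : ∀ {l j} → Unique l → downs (σ (take j l)) ≤ ups (σ (take j l)) → PrefixBallot l j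
⇒prefixBallot {l} {j} l! p =
  ≤⇒≤ᵇ (subst₂ _≤_ (sym (des≡downs (Unique.take⁺ j l!))) (sym (asc≡ups (take j l))) p)

ballot⇒Ballot : ∀ {l} → Unique l → T (ballot l) → Ballot (σ l)
ballot⇒Ballot {[]}    _  _ [] _ _ = z≤n
ballot⇒Ballot {x ∷ l} l! t u v eq =
  -- A prefix of `length u` steps comes from `suc (length u)` entries.
  subst (λ w → downs w ≤ ups w) σ≡ (prefixBallot⇒ {x ∷ l} {suc (length u)} l! prefix)
  where
  |u|≤ : length u ≤ length l
  |u|≤ = subst (length u ≤_)
    (trans (sym (length-++ u)) (trans (sym (cong length eq)) (length-σ x l))) (m≤m+n _ (length v))

  prefix : PrefixBallot (x ∷ l) (suc (length u))
  prefix = All.applyUpTo⁻ {P = PrefixBallot (x ∷ l)} id _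
    (All.all⁺ (λ j → des (take j (x ∷ l)) ≤ᵇ asc (take j (x ∷ l))) _ t) (s≤s (s≤s |u|≤))

  σ≡ : σ (take (suc (length u)) (x ∷ l)) ≡ u
  σ≡ = trans (σ-take x l (length u)) (trans (cong (take (length u)) eq) (take-length-++ u v))

Ballot⇒ballot : ∀ {l} → Unique l → Ballot (σ l) → T (ballot l)
Ballot⇒ballot {l} l! β = All.all⁻ (λ j → des (take j l) ≤ᵇ asc (take j l)) {upTo (suc (length l))}
  (All.applyUpTo⁺₂ {P = PrefixBallot l} id _ (λ j → ⇒prefixBallot {l} {j} l! (prefix l j β)))
  where
  prefix : ∀ l j → Ballot (σ l) → downs (σ (take j l)) ≤ ups (σ (take j l))
  prefix l       zero    β = z≤n
  prefix []      (suc j) β = z≤n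
  prefix (x ∷ l) (suc j) β = subst (λ w → downs w ≤ ups w) (sym (σ-take x l j))
    (β (take j (σ (x ∷ l))) (drop j (σ (x ∷ l))) (sym (take++drop≡id j (σ (x ∷ l)))))

-- Junk value: 0 on the empty list.
final : List ℕ → ℕ
final []          = 0
final (x ∷ [])    = x
final (x ∷ y ∷ l) = final (y ∷ l)

final-∷ʳ : ∀ l x → final (l ∷ʳ x) ≡ x
final-∷ʳ []          x = refl
final-∷ʳ (y ∷ [])    x = refl
final-∷ʳ (y ∷ z ∷ l) x = final-∷ʳ (z ∷ l) x

final-reverse : ∀ l → final (reverse l) ≡ nth l 0
final-reverse []      = refl
final-reverse (x ∷ l) = trans (cong final (unfold-reverse x l)) (final-∷ʳ (reverse l) x)

nth0-reverse : ∀ l → nth (reverse l) 0 ≡ final l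
nth0-reverse l = trans (sym (final-reverse (reverse l))) (cong final (reverse-involutive l))

final-∈ : ∀ x l → final (x ∷ l) ∈ x ∷ l
final-∈ x []      = here refl
final-∈ x (y ∷ l) = there (final-∈ y l)

σ-∷ʳ : ∀ x l z → σ ((x ∷ l) ∷ʳ z) ≡ σ (x ∷ l) ∷ʳ (final (x ∷ l) <ᵇ z)
σ-∷ʳ x []      z = refl
σ-∷ʳ x (y ∷ l) z = cong ((x <ᵇ y) ∷_) (σ-∷ʳ y l z)

σ-reverse : ∀ {l} → Unique l → σ (reverse l) ≡ reverse (map not (σ l))
σ-reverse []       = refl
σ-reverse (_ ∷ []) = refl
σ-reverse {x ∷ y ∷ l} ((x≢y ∷ _) ∷ l!) = begin
  σ (reverse (x ∷ y ∷ l))                           ≡⟨ cong σ (unfold-reverse x (y ∷ l)) ⟩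
  σ (reverse (y ∷ l) ∷ʳ x)                          ≡⟨ cong (λ w → σ (w ∷ʳ x)) (unfold-reverse y l) ⟩
  σ ((reverse l ∷ʳ y) ∷ʳ x)                         ≡⟨ σ-∷ʳ-∷ʳ (reverse l) ⟩
  σ (reverse l ∷ʳ y) ∷ʳ (y <ᵇ x)                    ≡⟨ cong₂ _∷ʳ_ (cong σ (sym (unfold-reverse y l))) (<ᵇ-flip x≢y) ⟩
  σ (reverse (y ∷ l)) ∷ʳ not (x <ᵇ y)               ≡⟨ cong (_∷ʳ not (x <ᵇ y)) (σ-reverse l!) ⟩
  reverse (map not (σ (y ∷ l))) ∷ʳ not (x <ᵇ y)     ≡⟨ sym (unfold-reverse (not (x <ᵇ y)) (map not (σ (y ∷ l)))) ⟩
  reverse (map not (σ (x ∷ y ∷ l)))                 ∎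
  where
  open ≡-Reasoning
  σ-∷ʳ-∷ʳ : ∀ w → σ ((w ∷ʳ y) ∷ʳ x) ≡ σ (w ∷ʳ y) ∷ʳ (y <ᵇ x)
  σ-∷ʳ-∷ʳ []      = refl
  σ-∷ʳ-∷ʳ (a ∷ w) = trans (σ-∷ʳ a (w ∷ʳ y) x) (cong (λ b → σ (a ∷ w ∷ʳ y) ∷ʳ (b <ᵇ x)) (final-∷ʳ (a ∷ w) y))

downs-reverse : ∀ {l} → Unique l → downs (σ (reverse l)) ≡ ups (σ l)
downs-reverse {l} l! = trans (cong downs (σ-reverse l!))
  (trans (countTrue-reverse not (map not (σ l))) (downs-not (σ l)))

-- The closing step and the cyclic word

closing : List ℕ → Bool
closing l = final l <ᵇ nth l 0

cyclicσ : List ℕ → List Bool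
cyclicσ []      = []
cyclicσ (x ∷ l) = σ ((x ∷ l) ∷ʳ x)

cyclicσ-∷ʳ : ∀ {l} → 0 < length l → cyclicσ l ≡ σ l ∷ʳ closing l
cyclicσ-∷ʳ {x ∷ l} _ = σ-∷ʳ x l x

length-cyclicσ : ∀ l → length (cyclicσ l) ≡ length l
length-cyclicσ []      = refl
length-cyclicσ (x ∷ l) = trans (length-σ x (l ∷ʳ x)) (trans (length-++ l) (+-comm (length l) 1))

cyclicσ-rot₁ : ∀ l → cyclicσ (rot₁ l) ≡ rot₁ (cyclicσ l)
cyclicσ-rot₁ []          = refl
cyclicσ-rot₁ (x ∷ [])    = refl
cyclicσ-rot₁ (x ∷ y ∷ l) = trans (σ-∷ʳ y (l ∷ʳ x) y)
  (cong (λ z → σ (y ∷ l ∷ʳ x) ∷ʳ (z <ᵇ y)) (final-∷ʳ (y ∷ l) x))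

cyclicσ-rot : ∀ k l → cyclicσ (rot k l) ≡ rot k (cyclicσ l)
cyclicσ-rot zero    l = refl
cyclicσ-rot (suc k) l = trans (cyclicσ-rot₁ (rot k l)) (cong rot₁ (cyclicσ-rot k l))

countTrue-rot : ∀ {A : Set} (p : A → Bool) k l → countTrue p (rot k l) ≡ countTrue p l
countTrue-rot p zero    l = refl
countTrue-rot p (suc k) l = trans (lem (rot k l)) (countTrue-rot p k l)
  where
  lem : ∀ l → countTrue p (rot₁ l) ≡ countTrue p l
  lem []      = refl
  lem (x ∷ l) = countTrue-comm p l [ x ]

-- Reversal swaps the first and the last entry. A single entry is both, and its closing step would
-- stay the same; the bound on the length excludes this.
closing-reverse : ∀ {l} → Unique l → 1 < length l → closing (reverse l) ≡ not (closing l)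
closing-reverse {l} l! 1<l rewrite final-reverse l | nth0-reverse l = <ᵇ-flip (final≢head l! 1<l)
  where
  final≢head : ∀ {l} → Unique l → 1 < length l → final l ≢ nth l 0
  final≢head {x ∷ []}    _        (s≤s ())
  final≢head {x ∷ y ∷ l} (x∉ ∷ _) _ eq = All.All¬⇒¬Any x∉ (subst (_∈ y ∷ l) eq (final-∈ y l))

-- A shift by `i` with `0 < i < length l` brings a different entry to the front when the entries are
-- distinct.
rot-unique-head : ∀ j {l} → Unique l → 0 < length l → nth (rot j l) 0 ≡ nth l 0 → rot j l ≡ l
rot-unique-head j {l} l! 0<l eq with rot-reduce j 0<l
... | i , i<l , rot≡ with split-at i {l} i<l
...   | []    , a , v , _    , refl = rot≡
rot-unique-head j {l} (x∉ ∷ _) 0<l eq | _ , i<l , rot≡ | x ∷ u , a , v , refl , refl =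
  contradiction (trans (sym eq) (cong (λ w → nth w 0) (trans rot≡ (rot-++ (x ∷ u) (a ∷ v)))))
    (All.lookup x∉ (∈-++⁺ʳ u (here refl)))

nth0-rot : ∀ {i l} → i < length l → nth (rot i l) 0 ≡ nth l i
nth0-rot {i} {l} i<l with split-at i {l} i<l
... | u , a , v , refl , refl = trans (cong (λ w → nth w 0) (rot-++ u (a ∷ v))) (lem u)
  where
  lem : ∀ u → a ≡ nth (u ++ a ∷ v) (length u)
  lem []      = refl
  lem (_ ∷ u) = lem u

-- Ballot permutations and circular arrangements

module _ (n : ℕ) where

  private

    m : ℕ

    m = suc (2 * n)

  BallotPerm : List ℕ → Set
  BallotPerm l = IsPermList m l × Ballot (σ l) × downs (σ l) ≡ n

  BallotPerm↓ : List ℕ → Set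
  BallotPerm↓ l = BallotPerm l × closing l ≡ false

  -- A circular arrangement is represented by its one rotation that starts with 0.
  CyclicPerm : List ℕ → Set
  CyclicPerm c = IsPermList m c × nth c 0 ≡ 0 × downs (cyclicσ c) ≡ suc n

  nonempty : ∀ {l} → IsPermList m l → 0 < length l
  nonempty π = <-≤-trans z<s (≤-reflexive (sym (length≡ π)))

  ups-σ : ∀ {l} → IsPermList m l → downs (σ l) ≡ n → ups (σ l) ≡ n
  ups-σ {[]}    (mkPerm () _ _)
  ups-σ {x ∷ l} π eq = +-cancelʳ-≡ n _ _ (begin
    ups s + n          ≡⟨ cong (ups s +_) (sym eq) ⟩
    ups s + downs s    ≡⟨ ups+downs s ⟩
    length s           ≡⟨ length-σ x l ⟩
    length l           ≡⟨ suc-injective (length≡ π) ⟩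
    2 * n              ≡⟨ cong (n +_) (+-identityʳ n) ⟩
    n + n              ∎)
    where
    open ≡-Reasoning
    s = σ (x ∷ l)

  ups-cyclicσ : ∀ {l} → IsPermList m l → downs (cyclicσ l) ≡ suc n → ups (cyclicσ l) ≡ n
  ups-cyclicσ {l} π eq = +-cancelʳ-≡ (suc n) _ _ (begin
    ups s + suc n          ≡⟨ cong (ups s +_) (sym eq) ⟩
    ups s + downs s        ≡⟨ ups+downs s ⟩
    length s               ≡⟨ length-cyclicσ l ⟩
    length l               ≡⟨ length≡ π ⟩
    suc (2 * n)            ≡⟨ cong (λ k → suc (n + k)) (+-identityʳ n) ⟩
    suc (n + n)            ≡⟨ sym (+-suc n n) ⟩
    n + suc n              ∎)
    where
    open ≡-Reasoning
    s = cyclicσ l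

  BallotPerm-reverse : ∀ {l} → BallotPerm l → BallotPerm (reverse l)
  BallotPerm-reverse {l} (π , β , d) =
    IsPermList-resp-↭ (↭-reverse l) π ,
    subst Ballot (sym (σ-reverse (unique π))) (Ballot-reverse β (trans d (sym (ups-σ π d)))) ,
    trans (downs-reverse (unique π)) (ups-σ π d)

  BallotPerm≃doubled : 0 < n → BallotPerm ≃ Doubled BallotPerm↓
  BallotPerm≃doubled 0<n = involution-halves reverse closing reverse-involutive
    (λ β cl → β , cl)
    (λ β@(π , _) cl → BallotPerm-reverse β , trans (rev-closing π) (cong not cl))
    id
    (λ (β@(π , _) , cl) → BallotPerm-reverse β , trans (rev-closing π) (cong not cl))
    where
    rev-closing : ∀ {l} → IsPermList m l → closing (reverse l) ≡ not (closing l)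
    rev-closing π = closing-reverse (unique π)
      (<-≤-trans (s≤s (≤-trans 0<n (m≤m+n n _))) (≤-reflexive (sym (length≡ π))))

  cyclic-imbalance : ∀ {l} → IsPermList m l → downs (cyclicσ l) ≡ suc n → downs (cyclicσ l) ≡ suc (ups (cyclicσ l))
  cyclic-imbalance π d = trans d (cong suc (sym (ups-cyclicσ π d)))

  BallotPerm↓⇒ : ∀ {l} → BallotPerm↓ l → ProperBallot (cyclicσ l) × downs (cyclicσ l) ≡ suc n
  BallotPerm↓⇒ {l} ((π , β , d) , cl) rewrite cyclicσ-∷ʳ {l} (nonempty π) | cl =
    Ballot⇒ProperBallot-∷ʳ β , trans (countTrue-++ not (σ l) [ false ]) (trans (+-comm _ 1) (cong suc d))

  ⇒BallotPerm↓ : ∀ {l} → IsPermList m l → ProperBallot (cyclicσ l) → downs (cyclicσ l) ≡ suc n → BallotPerm↓ l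
  ⇒BallotPerm↓ {l} π β d with ups-cyclicσ π d
  ... | u rewrite cyclicσ-∷ʳ {l} (nonempty π) with closing l
  ...   | false = (π , ProperBallot-∷ʳ⇒Ballot β , suc-injective
    (trans (+-comm 1 _) (trans (sym (countTrue-++ not (σ l) [ false ])) d))) , refl
  -- If the closing step ascended, the proper prefix `σ l` would contain all `n + 1` descents and at
  -- most `n` ascents.
  ...   | true  = contradiction (begin
    suc n                       ≡⟨ sym d ⟩
    downs (σ l ∷ʳ true)         ≡⟨ trans (countTrue-++ not (σ l) [ true ]) (+-identityʳ _) ⟩
    downs (σ l)                 ≤⟨ β (σ l) [ true ] refl (λ ()) ⟩
    ups (σ l)                   ≤⟨ m≤m+n _ 1 ⟩
    ups (σ l) + 1               ≡⟨ sym (countTrue-++ id (σ l) [ true ]) ⟩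
    ups (σ l ∷ʳ true)           ≡⟨ u ⟩
    n                           ∎) 1+n≰n
    where open ≤-Reasoning

  -- The two maps choose representatives of one circular arrangement: the rotation starting with 0
  -- and the ballot rotation. Each round trip is again a rotation of its argument, hence the
  -- identity, because either representative is unique.
  BallotPerm↓≃CyclicPerm : BallotPerm↓ ≃ CyclicPerm
  BallotPerm↓≃CyclicPerm = record
    { to        = zeroFirst
    ; from      = ballotFirst
    ; to-pres   = to-pres′
    ; from-pres = from-pres′
    ; from-to   = from-to′
    ; to-from   = λ {c} (π , h , d) → trans (rot-rot (index 0 (ballotFirst c)) (shift c) c)
        (rot-unique-head (index 0 (ballotFirst c) + shift c) (unique π) (nonempty π)
          (trans (cong (λ w → nth w 0) (sym (rot-rot (index 0 (ballotFirst c)) (shift c) c)))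
            (trans (head-zeroFirst (IsPermList-resp-↭ (rot-↭ (shift c) c) π)) (sym h))))
    }
    where
    zeroFirst : List ℕ → List ℕ
    zeroFirst l = rot (index 0 l) l
    shift : List ℕ → ℕ
    shift c = length (before (firstMinimum (cyclicσ c)))
    ballotFirst : List ℕ → List ℕ
    ballotFirst c = rot (shift c) c

    head-zeroFirst : ∀ {l} → IsPermList m l → nth (zeroFirst l) 0 ≡ 0
    head-zeroFirst π = let i< , eq = index-∈ (perm-∈ π z<s) in trans (nth0-rot i<) eq

    downs-rot : ∀ k {l} → downs (cyclicσ l) ≡ suc n → downs (cyclicσ (rot k l)) ≡ suc n
    downs-rot k {l} d = trans (cong downs (cyclicσ-rot k l)) (trans (countTrue-rot not k (cyclicσ l)) d)

    ballotFirst-proper : ∀ {c} → IsPermList m c → downs (cyclicσ c) ≡ suc n → ProperBallot (cyclicσ (ballotFirst c))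
    ballotFirst-proper {c} π d = subst ProperBallot (sym (cyclicσ-rot (shift c) c))
      (rot-firstMinimum-ballot (firstMinimum (cyclicσ c)) (cyclic-imbalance π d))

    to-pres′ : ∀ {l} → BallotPerm↓ l → CyclicPerm (zeroFirst l)
    to-pres′ {l} β@((π , _) , _) =
      IsPermList-resp-↭ (rot-↭ (index 0 l) l) π , head-zeroFirst π , downs-rot (index 0 l) {l} (proj₂ (BallotPerm↓⇒ β))

    from-pres′ : ∀ {c} → CyclicPerm c → BallotPerm↓ (ballotFirst c)
    from-pres′ {c} (π , _ , d) =
      ⇒BallotPerm↓ (IsPermList-resp-↭ (rot-↭ (shift c) c) π) (ballotFirst-proper π d) (downs-rot (shift c) {c} d)

    from-to′ : ∀ {l} → BallotPerm↓ l → ballotFirst (zeroFirst l) ≡ l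
    from-to′ {l} β@((π , _) , _) =
      let β′ , d = BallotPerm↓⇒ β
          π′ , _ , d′ = to-pres′ β
          j = shift (zeroFirst l) + index 0 l
          eq = rot-rot (shift (zeroFirst l)) (index 0 l) l
          -- The uniqueness of the ballot rotation concerns shifts below the length, so the
          -- composite shift is reduced modulo the length.
          i , i< , red = rot-reduce j (nonempty π)
          proper = subst ProperBallot (cyclicσ-rot i l)
                     (subst (ProperBallot ∘ cyclicσ) (trans eq red) (ballotFirst-proper π′ d′))
          i≡0 = ballot-rotation-unique (cyclic-imbalance π d) β′ proper
                  (<-≤-trans i< (≤-reflexive (sym (length-cyclicσ l))))
      in trans eq (trans red (cong (λ k → rot k l) i≡0))

-- Descent numbers and cutting at zero

DesPerm : ℕ → ℕ → List ℕ → Set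
DesPerm m d w = IsPermList m w × des w ≡ d

inE≃DesPerm : ∀ m d → (T ∘ inE (suc m) d) ≃ DesPerm (suc m) d
inE≃DesPerm m d = ≃-trans
  (≃-id (λ {v} t → let a , e = ∧⁻ {isPerm v} t in a , ≡ᵇ⇒≡ _ _ e)
        (λ {v} (a , e) → ∧⁺ {isPerm v} a (≡⇒≡ᵇ _ _ e)))
  (isPerm≃IsPermList (λ l → des l ≡ d))

DesPerm-reverse : ∀ {m d d′} → d + d′ ≡ m → DesPerm (suc m) d ≃ DesPerm (suc m) d′
DesPerm-reverse {m} {d} {d′} sum = record
  { to = reverse ; from = reverse
  ; to-pres = pres sum ; from-pres = pres (trans (+-comm d′ d) sum)
  ; from-to = λ _ → reverse-involutive _ ; to-from = λ _ → reverse-involutive _ }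
  where
  pres : ∀ {d d′ w} → d + d′ ≡ m → DesPerm (suc m) d w → DesPerm (suc m) d′ (reverse w)
  pres {w = []} _ (mkPerm () _ _ , _)
  pres {d} {d′} {w = x ∷ w} sum (π , e) = π′ , (begin
    des (reverse (x ∷ w))        ≡⟨ des≡downs (unique π′) ⟩
    downs (σ (reverse (x ∷ w)))  ≡⟨ downs-reverse (unique π) ⟩
    ups (σ (x ∷ w))              ≡⟨ +-cancelʳ-≡ d _ _ lem ⟩
    d′                           ∎)
    where
    open ≡-Reasoning
    π′ = IsPermList-resp-↭ (↭-reverse (x ∷ w)) π
    lem : ups (σ (x ∷ w)) + d ≡ d′ + d
    lem = begin
      ups (σ (x ∷ w)) + d                    ≡⟨ cong (ups (σ (x ∷ w)) +_) (trans (sym e) (des≡downs (unique π))) ⟩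
      ups (σ (x ∷ w)) + downs (σ (x ∷ w))    ≡⟨ ups+downs (σ (x ∷ w)) ⟩
      length (σ (x ∷ w))                     ≡⟨ length-σ x w ⟩
      length w                               ≡⟨ suc-injective (length≡ π) ⟩
      m                                      ≡⟨ sym sum ⟩
      d + d′                                 ≡⟨ +-comm d d′ ⟩
      d′ + d                                 ∎

-- `Q` is left open because the cut is made on both sides: with the descents of `cyclicσ` for ballot
-- permutations and with `Mc` for odd cycles.
deleteZero≃ : ∀ {m} (Q : List ℕ → Set) →
  (λ c → IsPermList (suc m) c × nth c 0 ≡ 0 × Q c) ≃ (λ w → IsPermList m w × Q (0 ∷ map suc w))
deleteZero≃ {m} Q = record
  { to        = shrink
  ; from      = λ w → 0 ∷ map suc w
  ; to-pres   = λ (π , h , q) → let c≡ = grow-shrink π h in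
      shrink-perm (subst (IsPermList (suc m)) (sym c≡) π) , subst Q (sym c≡) q
  ; from-pres = λ {w} (π , q) →
      mkPerm (cong suc (trans (length-map suc w) (length≡ π)))
             (All.map⁺ (All.universal (λ _ ()) _) ∷ Unique.map⁺ suc-injective (unique π))
             (z<s ∷ All.map⁺ (All.map s<s (bounded π)))
      , refl , q
  ; from-to   = λ (π , h , _) → grow-shrink π h
  ; to-from   = λ {w} _ → trans (sym (map-∘ w)) (map-id w)
  }
  where
  shrink : List ℕ → List ℕ
  shrink c = map pred (drop 1 c)

  suc-pred-map : ∀ {l} → All (0 ≢_) l → map suc (map pred l) ≡ l
  suc-pred-map []               = refl
  suc-pred-map {zero ∷ _} (0≢0 ∷ _) = contradiction refl 0≢0
  suc-pred-map {suc x ∷ _} (_ ∷ p) = cong (suc x ∷_) (suc-pred-map p)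

  grow-shrink : ∀ {c} → IsPermList (suc m) c → nth c 0 ≡ 0 → 0 ∷ map suc (shrink c) ≡ c
  grow-shrink {[]}    (mkPerm () _ _)
  grow-shrink {x ∷ c} (mkPerm _ (x∉ ∷ _) _) refl = cong (0 ∷_) (suc-pred-map x∉)

  shrink-perm : ∀ {w} → IsPermList (suc m) (0 ∷ map suc w) → IsPermList m w
  shrink-perm {w} (mkPerm len (_ ∷ u) (_ ∷ b)) =
    mkPerm (trans (sym (length-map suc w)) (suc-injective len)) (Unique.map⁻ u) (All.map s<s⁻¹ (All.map⁻ b))

σ-map-suc : ∀ l → σ (map suc l) ≡ σ l
σ-map-suc []          = refl
σ-map-suc (x ∷ [])    = refl
σ-map-suc (x ∷ y ∷ l) = cong ((x <ᵇ y) ∷_) (σ-map-suc (y ∷ l))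

-- The step out of 0 ascends and the step back into 0 descends, so only the latter adds to the
-- descents of `w`.
downs-cyclicσ-zero : ∀ {w} → 0 < length w → downs (cyclicσ (0 ∷ map suc w)) ≡ suc (downs (σ w))
downs-cyclicσ-zero {x ∷ w} _ = begin
  downs (σ (map suc (x ∷ w) ∷ʳ 0))        ≡⟨ cong downs (σ-∷ʳ (suc x) (map suc w) 0) ⟩
  downs (σ (map suc (x ∷ w)) ∷ʳ false)    ≡⟨ countTrue-++ not (σ (map suc (x ∷ w))) [ false ] ⟩
  downs (σ (map suc (x ∷ w))) + 1         ≡⟨ +-comm _ 1 ⟩
  suc (downs (σ (map suc (x ∷ w))))       ≡⟨ cong (suc ∘ downs) (σ-map-suc (x ∷ w)) ⟩
  suc (downs (σ (x ∷ w)))                 ∎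
  where open ≡-Reasoning

inB≃BallotPerm : ∀ n → (T ∘ inB (suc (2 * n)) n) ≃ BallotPerm n
inB≃BallotPerm n = ≃-trans
  (≃-id (λ {v} t → let a , be = ∧⁻ {isPerm v} t ; b , e = ∧⁻ {ballot (oneLine v)} be
                       u = unique (isPerm⇒IsPermList {v = v} a) in
           a , ballot⇒Ballot u b , trans (sym (des≡downs u)) (≡ᵇ⇒≡ _ _ e))
        (λ {v} (a , b , e) → let u = unique (isPerm⇒IsPermList {v = v} a) in
           ∧⁺ {isPerm v} a (∧⁺ (Ballot⇒ballot u b) (≡⇒≡ᵇ _ _ (trans (des≡downs u) e)))))
  (isPerm≃IsPermList (λ l → Ballot (σ l) × downs (σ l) ≡ n))

CyclicPerm≃DesPerm : ∀ n → 0 < n → CyclicPerm n ≃ DesPerm (2 * n) n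
CyclicPerm≃DesPerm n 0<n = ≃-trans (deleteZero≃ (λ c → downs (cyclicσ c) ≡ suc n))
  (≃-id (λ {w} (π , e) → π , trans (des≡downs (unique π))
          (suc-injective (trans (sym (downs-cyclicσ-zero {w} (0<length π))) e)))
        (λ {w} (π , e) → π , trans (downs-cyclicσ-zero {w} (0<length π))
          (cong suc (trans (sym (des≡downs (unique π))) e))))
  where
  0<length : ∀ {w} → IsPermList (2 * n) w → 0 < length w
  0<length π = <-≤-trans 0<n (≤-trans (m≤m+n n _) (≤-reflexive (sym (length≡ π))))

-- The right-hand side is the predecessor of `2 * suc k` in unfolded form: the number of adjacent
-- pairs in a permutation of [2n] with n = k+1.
middle-sum : ∀ k → suc k + k ≡ k + (suc k + 0)
middle-sum k = trans (+-comm (suc k) k) (cong (k +_) (sym (+-identityʳ (suc k))))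

-- A descending closing step leads to permutations of [2n] with n descents, whereas `EC` is defined
-- by n-1 descents; a second reversal, now on [2n], passes from one to the other.
inB≃doubled-inE : ∀ k → let n = suc k in (T ∘ inB (suc (2 * n)) n) ≃ Doubled (T ∘ inE (2 * n) k)
inB≃doubled-inE k = ≃-trans (inB≃BallotPerm n) (≃-trans (BallotPerm≃doubled n z<s)
  (Doubled-cong (≃-trans (BallotPerm↓≃CyclicPerm n) (≃-trans (CyclicPerm≃DesPerm n z<s)
    (≃-trans (DesPerm-reverse (middle-sum k)) (≃-sym (inE≃DesPerm _ k)))))))
  where
  n : ℕ
  n = suc k

-- Iterates and periods of a map

nth-applyUpTo : ∀ (g : ℕ → ℕ) {n i} → i < n → nth (applyUpTo g n) i ≡ g i
nth-applyUpTo g {suc n} {zero}  _  = refl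
nth-applyUpTo g {suc n} {suc i} i< = nth-applyUpTo (g ∘ suc) (s<s⁻¹ i<)

nth-injective⇒Unique : ∀ l → (∀ {i j} → i < length l → j < length l → nth l i ≡ nth l j → i ≡ j) → Unique l
nth-injective⇒Unique []      _   = []
nth-injective⇒Unique (x ∷ l) inj =
  All.tabulate (λ {y} y∈l x≡y → let j< , eq = index-∈ y∈l in
    contradiction (inj z<s (s<s j<) (trans x≡y (sym eq))) λ ())
  ∷ nth-injective⇒Unique l (λ i< j< eq → suc-injective (inj (s<s i<) (s<s j<) eq))

-- The innermost application comes first, in step with the recursion of `orbitFrom`; `pow-suc`
-- provides the other form.
pow : {A : Set} → (A → A) → ℕ → A → A
pow f zero    x = x
pow f (suc k) x = pow f k (f x)

module _ {A : Set} (f : A → A) where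

  pow-suc : ∀ k x → pow f (suc k) x ≡ f (pow f k x)
  pow-suc zero    x = refl
  pow-suc (suc k) x = pow-suc k (f x)

  pow-+ : ∀ j k x → pow f (j + k) x ≡ pow f k (pow f j x)
  pow-+ zero    k x = refl
  pow-+ (suc j) k x = pow-+ j k (f x)

  pow-comm : ∀ j k x → pow f j (pow f k x) ≡ pow f k (pow f j x)
  pow-comm j k x = trans (sym (pow-+ k j x)) (trans (cong (λ i → pow f i x) (+-comm k j)) (pow-+ j k x))

  record Period (x : A) (r : ℕ) : Set where
    field
      positive : 0 < r
      returns  : pow f r x ≡ x
      minimal  : ∀ {j} → 0 < j → j < r → pow f j x ≢ x

  open Period

  period-unique : ∀ {x r s} → Period x r → Period x s → r ≡ s
  period-unique P Q = ≤-antisym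
    (≮⇒≥ (λ s<r → minimal P (positive Q) s<r (returns Q)))
    (≮⇒≥ (λ r<s → minimal Q (positive P) r<s (returns P)))

  module _ (f-inj : Injective _≡_ _≡_ f) where

    pow-injective : ∀ k {x y} → pow f k x ≡ pow f k y → x ≡ y
    pow-injective zero    eq = eq
    pow-injective (suc k) eq = f-inj (pow-injective k eq)

    pow-collision : ∀ {i j x} → i ≤ j → pow f i x ≡ pow f j x → pow f (j ∸ i) x ≡ x
    pow-collision {i} {j} {x} i≤j eq = sym (pow-injective i (trans eq
      (trans (cong (λ k → pow f k x) (sym (m∸n+n≡m i≤j))) (pow-+ (j ∸ i) i x))))

    period-pow : ∀ {x r} k → Period x r → Period (pow f k x) r
    period-pow {x} {r} k P = record
      { positive = positive P
      ; returns  = trans (pow-comm r k x) (cong (pow f k) (returns P))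
      ; minimal  = λ {j} 0<j j<r eq → minimal P 0<j j<r (pow-injective k (trans (pow-comm k j x) eq))
      }

    period-distinct : ∀ {x r i j} → Period x r → i < j → j < r → pow f i x ≢ pow f j x
    period-distinct {i = i} {j} P i<j j<r eq =
      minimal P (m<n⇒0<n∸m i<j) (≤-<-trans (m∸n≤m j i) j<r) (pow-collision (<⇒≤ i<j) eq)

  pow-reduce : ∀ {x r} → Period x r → ∀ k → ∃ λ i → i < r × pow f k x ≡ pow f i x
  pow-reduce P zero    = 0 , positive P , refl
  pow-reduce {x} {r} P (suc k) with pow-reduce P k
  ... | i , i<r , eq with suc i <? r
  ...   | yes i+1<r = suc i , i+1<r , trans (pow-suc k x) (trans (cong f eq) (sym (pow-suc i x)))
  ...   | no  i+1≮r = 0 , positive P , trans (pow-suc k x) (trans (cong f eq)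
    (trans (sym (pow-suc i x)) (trans (cong (λ s → pow f s x) (≤-antisym i<r (≮⇒≥ i+1≮r))) (returns P))))

  -- Completing the round by the remaining `r ∸ i` steps takes the place of an inverse of `f`.
  pow-back : ∀ {x r} → Period x r → ∀ k → ∃ λ j → pow f j (pow f k x) ≡ x
  pow-back {x} {r} P k = let i , i<r , eq = pow-reduce P k in
    r ∸ i , trans (cong (pow f (r ∸ i)) eq)
      (trans (sym (pow-+ i (r ∸ i) x)) (trans (cong (λ s → pow f s x) (m+[n∸m]≡n (<⇒≤ i<r))) (returns P)))

-- Orbits of a permutation

module Orbits {N : ℕ} (v : Vec (Fin (suc N)) (suc N)) (v-perm : T (isPerm v)) where

  private

    m : ℕ

    m = suc N

  f : Fin m → Fin m
  f = Vec.lookup v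

  f-injective : Injective _≡_ _≡_ f
  f-injective {i} {j} eq = toℕ-injective (nth-injective (distinct⇒Unique (oneLine v) v-perm) (bound i) (bound j)
    (trans (nth-toList v i) (trans (cong toℕ eq) (sym (nth-toList v j)))))
    where
    bound : ∀ i → toℕ i < length (oneLine v)
    bound i = <-≤-trans (toℕ<n i) (≤-reflexive (sym (length-oneLine v)))

  trajectory : Fin m → ℕ → ℕ
  trajectory x k = toℕ (pow f k x)

  orbitFrom-spec : ∀ x fuel y → ∃ λ t →
    orbitFrom v fuel x y ≡ applyUpTo (trajectory y) t
    × (∀ {j} → j < t → pow f j y ≢ x) × (t ≡ fuel ⊎ pow f t y ≡ x)
  orbitFrom-spec x zero       y = 0 , refl , (λ ()) , inj₁ refl
  orbitFrom-spec x (suc fuel) y with toℕ y ≡ᵇ toℕ x in eq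
  ... | true  = 0 , refl , (λ ()) , inj₂ (toℕ-injective (≡ᵇ⇒≡ _ _ (subst T (sym eq) _)))
  ... | false with orbitFrom-spec x fuel (f y)
  ...   | t , eq′ , no-return , end = suc t , cong (toℕ y ∷_) eq′ , no-return′ , end′ end
    where
    no-return′ : ∀ {j} → j < suc t → pow f j y ≢ x
    no-return′ {zero}  _  y≡x = subst T eq (≡⇒≡ᵇ _ _ (cong toℕ y≡x))
    no-return′ {suc j} j<     = no-return (s<s⁻¹ j<)
    end′ : t ≡ fuel ⊎ pow f t (f y) ≡ x → suc t ≡ suc fuel ⊎ pow f t (f y) ≡ x
    end′ (inj₁ e) = inj₁ (cong suc e)
    end′ (inj₂ e) = inj₂ e

  orbit-spec : ∀ x → ∃ λ r → Period f x r × orbit v x ≡ applyUpTo (trajectory x) r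
  orbit-spec x with orbitFrom-spec x m (f x)
  ... | t , eq , no-return , end = suc t , record
      { positive = z<s
      ; returns  = returns′ end
      ; minimal  = λ { {suc j} _ j< → no-return (s<s⁻¹ j<) }
      } , cong (toℕ x ∷_) eq
    where
    returns′ : t ≡ m ⊎ pow f t (f x) ≡ x → pow f t (f x) ≡ x
    returns′ (inj₂ e) = e
    -- The fuel cannot run out: among the `m + 1` iterates of `x` with exponents 0 to `m` two
    -- coincide, so `x` recurs within `m` steps, against `no-return`.
    returns′ (inj₁ t≡m) with pigeonhole (n<1+n m) (λ i → pow f (toℕ i) x)
    ... | i , j , i<j , e with toℕ j ∸ toℕ i | m<n⇒0<n∸m i<j | pow-collision f f-injective (<⇒≤ i<j) e
                             | m∸n≤m (toℕ j) (toℕ i)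
    ...   | suc d | _ | back | d< = contradiction back (no-return
      (<-≤-trans d< (≤-trans (s≤s⁻¹ (toℕ<n j)) (≤-reflexive (sym t≡m)))))

  orbit≡ : ∀ {x r} → Period f x r → orbit v x ≡ applyUpTo (trajectory x) r
  orbit≡ {x} P = let s , Q , eq = orbit-spec x in
    trans eq (cong (applyUpTo (trajectory x)) (period-unique f Q P))

  orbit-unique : ∀ x → Unique (orbit v x)
  orbit-unique x = let r , P , eq = orbit-spec x in subst Unique (sym eq)
    (Unique.applyUpTo⁺₁ (trajectory x) r (λ i<j j<r e → period-distinct f f-injective P i<j j<r (toℕ-injective e)))

  orbit-bounded : ∀ x → All (_< m) (orbit v x)
  orbit-bounded x = let r , _ , eq = orbit-spec x in subst (All (_< m)) (sym eq)
    (All.applyUpTo⁺₂ (trajectory x) r (λ i → toℕ<n (pow f i x)))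

  ∈-orbit⁻ : ∀ {x y} → y ∈ orbit v x → ∃ λ k → y ≡ toℕ (pow f k x)
  ∈-orbit⁻ {x} {y} y∈ =
    let r , _ , eq = orbit-spec x
        k , _ , y≡ = ∈-applyUpTo⁻ (trajectory x) (subst (y ∈_) eq y∈)
    in k , y≡

  ∈-orbit⁺ : ∀ {x} k → toℕ (pow f k x) ∈ orbit v x
  ∈-orbit⁺ {x} k = let r , P , eq = orbit-spec x
                       i , i<r , e = pow-reduce f P k
                   in subst (toℕ (pow f k x) ∈_) (sym eq)
                        (subst (_∈ _) (cong toℕ (sym e)) (∈-applyUpTo⁺ (trajectory x) i<r))

  ∈-orbit-back : ∀ {x} k → toℕ x ∈ orbit v (pow f k x)
  ∈-orbit-back {x} k = let _ , P , _ = orbit-spec x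
                           j , e = pow-back f P k
                       in subst (_∈ orbit v (pow f k x)) (cong toℕ e) (∈-orbit⁺ j)

  cycleMin-≤ : ∀ {x y} → T (isCycleMin v x) → y ∈ orbit v x → toℕ x ≤ y
  cycleMin-≤ {x} t y∈ = ≤ᵇ⇒≤ _ _ (All.lookup (All.all⁺ (λ y → toℕ x ≤ᵇ y) (orbit v x) t) y∈)

  cycleMin-zero : T (isCycleMin v zero)
  cycleMin-zero = All.all⁻ (λ y → 0 ≤ᵇ y) {orbit v zero} (All.universal (λ _ → _) _)

  -- Through the common point `y`, each of `x` and `x′` lies in the orbit of the other, so each is
  -- at most the other.
  orbits-meet : ∀ {x x′ y} → T (isCycleMin v x) → T (isCycleMin v x′) →
                y ∈ orbit v x → y ∈ orbit v x′ → x ≡ x′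
  orbits-meet {x} {x′} t t′ y∈ y∈′ =
    let k  , e  = ∈-orbit⁻ {x} y∈
        k′ , e′ = ∈-orbit⁻ {x′} y∈′
        z≡z′ = toℕ-injective (trans (sym e) e′)
    in toℕ-injective (≤-antisym (half k k′ t z≡z′) (half k′ k t′ (sym z≡z′)))
    where
    half : ∀ {x x′} k k′ → T (isCycleMin v x) → pow f k x ≡ pow f k′ x′ → toℕ x ≤ toℕ x′
    half {x} {x′} k k′ t e = let _ , P , _ = orbit-spec x′
                                 j , back = pow-back f P k′
                             in cycleMin-≤ {x} t (subst (_∈ orbit v x)
                                  (cong toℕ (trans (pow-+ f k j x) (trans (cong (pow f j) e) back))) (∈-orbit⁺ (k + j)))

  minOrbit : Fin m → List ℕ
  minOrbit x = if isCycleMin v x then orbit v x else []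

  -- Orbits of different cycle minima are disjoint, so the concatenation consists of distinct
  -- numbers below `m`.
  length-minOrbits : length (concat (map minOrbit (allFin m))) ≤ m
  length-minOrbits = unique-bounded⇒length≤
    (Unique.concat⁺ (All.map⁺ (All.universal minOrbit-unique (allFin m)))
      (AllPairs.map⁺ (AllPairs.map disjoint (Unique.allFin⁺ m))))
    (All.concat⁺ (All.map⁺ (All.universal minOrbit-bounded (allFin m))))
    where
    minOrbit-unique : ∀ x → Unique (minOrbit x)
    minOrbit-unique x with isCycleMin v x
    ... | true  = orbit-unique x
    ... | false = []
    minOrbit-bounded : ∀ x → All (_< m) (minOrbit x)
    minOrbit-bounded x with isCycleMin v x
    ... | true  = orbit-bounded x
    ... | false = []
    disjoint : ∀ {x x′} → x ≢ x′ → Disjoint (minOrbit x) (minOrbit x′)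
    disjoint {x} {x′} x≢x′ (y∈ , y∈′) with isCycleMin v x in eq | isCycleMin v x′ in eq′
    ... | true | true = x≢x′ (orbits-meet {x} {x′} (subst T (sym eq) _) (subst T (sym eq′) _) y∈ y∈′)
    disjoint x≢x′ (() , _)  | false | _
    disjoint x≢x′ (_  , ()) | true  | false

-- Cyclic ascents and descents of one cycle

<ᵇ≡not-≤ᵇ : ∀ a b → (b <ᵇ a) ≡ not (a ≤ᵇ b)
<ᵇ≡not-≤ᵇ zero    b       = refl
<ᵇ≡not-≤ᵇ (suc a) zero    = refl
<ᵇ≡not-≤ᵇ (suc zero) (suc b)    = refl
<ᵇ≡not-≤ᵇ (suc (suc a)) (suc b) = <ᵇ≡not-≤ᵇ (suc a) b

countTrue-complement : {A : Set} (p q : A → Bool) → (∀ x → q x ≡ not (p x)) →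
                       ∀ xs → countTrue p xs + countTrue q xs ≡ length xs
countTrue-complement p q h []       = refl
countTrue-complement p q h (x ∷ xs) rewrite h x with p x
... | true  = cong suc (countTrue-complement p q h xs)
... | false = trans (+-suc _ _) (cong suc (countTrue-complement p q h xs))

cA+cD : ∀ c → cA c + cD c ≡ length c
cA+cD c = trans (countTrue-complement _ _ (λ (x , y) → <ᵇ≡not-≤ᵇ x y) (cycPairs c))
  (trans (length-zipWith _,_ c (rotate c)) (trans (cong (length c ⊓_) (length-rotate c)) (⊓-idem (length c))))
  where
  length-rotate : ∀ c → length (rotate c) ≡ length c
  length-rotate []      = refl
  length-rotate (x ∷ c) = trans (length-++ c) (+-comm (length c) 1)

odd-double : ∀ k → odd (k + k) ≡ false
odd-double zero    = refl
odd-double (suc k) = trans (cong (odd ∘ suc) (+-suc k k)) (odd-double k)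

odd-suc-double : ∀ k → odd (suc (k + k)) ≡ true
odd-suc-double zero    = refl
odd-suc-double (suc k) = trans (cong odd (+-suc k k)) (odd-suc-double k)

2*≡+ : ∀ k → 2 * k ≡ k + k
2*≡+ k = cong (k +_) (+-identityʳ k)

-- Twice the minimum is at most `cA c + cD c`, which is the length; equality would make the length
-- even.
Mc-bound : ∀ {c} → T (odd (length c)) → 2 * Mc c + 1 ≤ length c
Mc-bound {c} o = subst (_≤ length c) (+-comm 1 (2 * Mc c)) (≤∧≢⇒<
  (begin
    2 * Mc c       ≡⟨ 2*≡+ (Mc c) ⟩
    Mc c + Mc c    ≤⟨ +-mono-≤ (m⊓n≤m (cA c) (cD c)) (m⊓n≤n (cA c) (cD c)) ⟩
    cA c + cD c    ≡⟨ cA+cD c ⟩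
    length c       ∎)
  (λ eq → subst T (trans (cong odd (trans (sym eq) (2*≡+ (Mc c)))) (odd-double (Mc c))) o))
  where open ≤-Reasoning

Mc≡n⇒ : ∀ {c n} → length c ≡ suc (2 * n) → Mc c ≡ n → cD c ≡ n ⊎ cD c ≡ suc n
Mc≡n⇒ {c} {n} len M with ⊓-sel (cA c) (cD c)
... | inj₂ e = inj₁ (trans (sym e) M)
... | inj₁ e = inj₂ (+-cancelˡ-≡ n _ _ (begin
  n + cD c       ≡⟨ cong (_+ cD c) (trans (sym M) e) ⟩
  cA c + cD c    ≡⟨ trans (cA+cD c) len ⟩
  suc (2 * n)    ≡⟨ cong suc (2*≡+ n) ⟩
  suc (n + n)    ≡⟨ sym (+-suc n n) ⟩
  n + suc n      ∎))
  where open ≡-Reasoning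

⇒Mc≡n : ∀ {c n} → length c ≡ suc (2 * n) → cD c ≡ n ⊎ cD c ≡ suc n → Mc c ≡ n
⇒Mc≡n {c} {n} len (inj₁ e) = trans (cong₂ _⊓_ a≡ e) (m≥n⇒m⊓n≡n (n≤1+n n))
  where
  a≡ : cA c ≡ suc n
  a≡ = +-cancelʳ-≡ n _ _ (trans (cong (cA c +_) (sym e)) (trans (cA+cD c) (trans len (cong suc (2*≡+ n)))))
⇒Mc≡n {c} {n} len (inj₂ e) = trans (cong₂ _⊓_ a≡ e) (m≤n⇒m⊓n≡m (n≤1+n n))
  where
  a≡ : cA c ≡ n
  a≡ = +-cancelʳ-≡ (suc n) _ _ (trans (cong (cA c +_) (sym e)) (trans (cA+cD c)
    (trans len (trans (cong suc (2*≡+ n)) (sym (+-suc n n))))))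

cD≡des : ∀ x l → cD (x ∷ l) ≡ des ((x ∷ l) ∷ʳ x)
cD≡des x l = lem x l x
  where
  lem : ∀ x l z → countTrue (λ p → proj₂ p <ᵇ proj₁ p) (zip (x ∷ l) (l ∷ʳ z)) ≡ des ((x ∷ l) ∷ʳ z)
  lem x [] z with z <ᵇ x
  ... | true  = refl
  ... | false = refl
  lem x (y ∷ l) z with y <ᵇ x | lem y l z
  ... | true  | eq = cong suc eq
  ... | false | eq = eq

des-map-suc-∷ʳ : ∀ x l → des (map suc (x ∷ l) ∷ʳ 0) ≡ suc (des (x ∷ l))
des-map-suc-∷ʳ x []      = refl
des-map-suc-∷ʳ x (y ∷ l) = trans (cong ((if y <ᵇ x then 1 else 0) +_) (des-map-suc-∷ʳ y l))
  (+-suc (if y <ᵇ x then 1 else 0) _)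

cD-zero : ∀ {w} → 0 < length w → cD (0 ∷ map suc w) ≡ suc (des w)
cD-zero {x ∷ w} _ = trans (cD≡des 0 (map suc (x ∷ w))) (des-map-suc-∷ʳ x w)

-- From odd-cycle permutations to single cycles

open Period

CyclePerm : ℕ → List ℕ → Set
CyclePerm n c = IsPermList (suc (2 * n)) c × nth c 0 ≡ 0 × Mc c ≡ n

module _ {N : ℕ} (v : Vec (Fin (suc N)) (suc N)) where

  minM : Fin (suc N) → ℕ
  minM x = if isCycleMin v x then Mc (orbit v x) else 0

  sum-minM-no-min : ∀ xs → countTrue (isCycleMin v) xs ≡ 0 → sum (map minM xs) ≡ 0
  sum-minM-no-min []       _  = refl
  sum-minM-no-min (x ∷ xs) eq with isCycleMin v x
  ... | false = sum-minM-no-min xs eq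

  -- 0 is always the least element of its cycle; if no other point is a cycle minimum, the sum
  -- `Mperm` has this one term.
  tail-zero⇒Mperm≡ : T (isPerm v) → countTrue (isCycleMin v) (tabulate suc) ≡ 0 → Mperm v ≡ Mc (orbit v zero)
  tail-zero⇒Mperm≡ vp eq rewrite Equivalence.to T-≡ (Orbits.cycleMin-zero v vp) | sum-minM-no-min (tabulate suc) eq =
    +-identityʳ _

-- The last entry of c is sent to the junk value 0 of nth, which is the first entry of the lists c used below.
next : List ℕ → ℕ → ℕ
next c i = nth c (suc (index i c))

-- In `bound` every cycle minimum supplies the 1 of its own `Mc-bound`, so the sum limits the number
-- of cycles to one. Applied once more to the cycle of 0, which now carries all of M, `Mc-bound`
-- shows that this cycle has full length.
inP⇒CyclePerm : ∀ {n v} → T (inP (suc (2 * n)) n v) → CyclePerm n (orbit v zero)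
inP⇒CyclePerm {n} {v} t = mkPerm |orbit| (orbit-unique zero) (orbit-bounded zero) , refl , Mc≡n
  where
  m : ℕ
  m = suc (2 * n)
  t₁ = ∧⁻ {isPerm v} t
  t₂ = ∧⁻ {allCyclesOdd v} (proj₂ t₁)
  open Orbits v (proj₁ t₁)
  open ≤-Reasoning

  odd-orbit : ∀ x → T (odd (length (orbit v x)))
  odd-orbit x = All.tabulate⁻ {f = id} (All.all⁺ (λ x → odd (length (orbit v x))) (allFin m) (proj₁ t₂)) x

  M≡n : Mperm v ≡ n
  M≡n = ≡ᵇ⇒≡ _ _ (proj₂ t₂)

  bound : ∀ xs → 2 * sum (map (minM v) xs) + countTrue (isCycleMin v) xs ≤ length (concat (map minOrbit xs))
  bound []       = z≤n
  bound (x ∷ xs) with isCycleMin v x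
  ... | false = bound xs
  ... | true  = begin
    2 * (Mc c + s) + suc k            ≡⟨ rearrange (Mc c) s k ⟩
    (2 * Mc c + 1) + (2 * s + k)      ≤⟨ +-mono-≤ (Mc-bound {c} (odd-orbit x)) (bound xs) ⟩
    length c + length (concat (map minOrbit xs)) ≡⟨ sym (length-++ c) ⟩
    length (c ++ concat (map minOrbit xs)) ∎
    where
    c = orbit v x
    s = sum (map (minM v) xs)
    k = countTrue (isCycleMin v) xs
    rearrange : ∀ a s k → 2 * (a + s) + suc k ≡ (2 * a + 1) + (2 * s + k)
    rearrange = solve 3 (λ a s k → con 2 :* (a :+ s) :+ (con 1 :+ k) := (con 2 :* a :+ con 1) :+ (con 2 :* s :+ k)) refl
      where open +-*-Solver

  #mins : List (Fin m) → ℕ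
  #mins = countTrue (isCycleMin v)

  #mins≤1 : #mins (allFin m) ≤ 1
  #mins≤1 = +-cancelˡ-≤ (2 * n) _ _ (begin
    2 * n + #mins (allFin m)                     ≡⟨ cong (λ k → 2 * k + #mins (allFin m)) (sym M≡n) ⟩
    2 * Mperm v + #mins (allFin m)               ≤⟨ bound (allFin m) ⟩
    length (concat (map minOrbit (allFin m)))    ≤⟨ length-minOrbits ⟩
    suc (2 * n)                                  ≡⟨ +-comm 1 (2 * n) ⟩
    2 * n + 1                                    ∎)

  tail-zero : #mins (tabulate suc) ≡ 0
  tail-zero = n≤0⇒n≡0 (s≤s⁻¹ (subst (_≤ 1) #mins-allFin #mins≤1))
    where
    #mins-allFin : #mins (allFin m) ≡ suc (#mins (tabulate suc))
    #mins-allFin = cong (λ t → if t then suc (#mins (tabulate suc)) else #mins (tabulate suc))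
      (Equivalence.to T-≡ cycleMin-zero)

  Mc≡n : Mc (orbit v zero) ≡ n
  Mc≡n = trans (sym (tail-zero⇒Mperm≡ v (proj₁ t₁) tail-zero)) M≡n

  |orbit| : length (orbit v zero) ≡ m
  |orbit| = ≤-antisym (unique-bounded⇒length≤ (orbit-unique zero) (orbit-bounded zero)) (begin
    suc (2 * n)                  ≡⟨ +-comm 1 (2 * n) ⟩
    2 * n + 1                    ≡⟨ cong (λ k → 2 * k + 1) (sym Mc≡n) ⟩
    2 * Mc (orbit v zero) + 1    ≤⟨ Mc-bound {orbit v zero} (odd-orbit zero) ⟩
    length (orbit v zero)        ∎)

module _ {N : ℕ} (v : Vec (Fin (suc N)) (suc N)) (v-perm : T (isPerm v)) where

  open Orbits v v-perm

  tabulateℕ-next-orbit : IsPermList (suc N) (orbit v zero) → tabulateℕ (next (orbit v zero)) ≡ v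
  tabulateℕ-next-orbit π = tabulateℕ-lookup (next c) v step
    where
    c = orbit v zero
    period : Period f zero (suc N)
    period = let r , P , eq = orbit-spec zero in
      subst (Period f zero)
        (trans (sym (length-applyUpTo (trajectory zero) r)) (trans (sym (cong length eq)) (length≡ π))) P
    nth-c : ∀ {i} → i < suc N → nth c i ≡ toℕ (pow f i zero)
    nth-c {i} i< = trans (cong (λ l → nth l i) (orbit≡ period)) (nth-applyUpTo (trajectory zero) i<)
    step : ∀ y → next c (toℕ y) ≡ toℕ (f y)
    step y with index-∈ (perm-∈ π (toℕ<n y))
    ... | k< , eq = trans (go (suc k <? suc N))
      (cong toℕ (trans (pow-suc f k zero) (cong f (toℕ-injective (trans (sym (nth-c k<m)) eq)))))
      where
      k = index (toℕ y) c
      k<m : k < suc N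
      k<m = <-≤-trans k< (≤-reflexive (length≡ π))
      go : Dec (suc k < suc N) → nth c (suc k) ≡ toℕ (pow f (suc k) zero)
      go (yes k+1<m) = nth-c k+1<m
      -- At the last entry `next` reads past the end and gets the default 0, which is where the
      -- cycle does return.
      go (no  k+1≮m) = trans (cong (nth c) (trans k+1≡m (sym (length≡ π)))) (trans (nth-overflow c)
          (cong toℕ (sym (trans (cong (λ j → pow f j zero) k+1≡m) (returns period)))))
        where
        k+1≡m : suc k ≡ suc N
        k+1≡m = ≤-antisym k<m (≮⇒≥ k+1≮m)

-- Recovering a permutation from its single cycle

module Reconstruct {N : ℕ} {c : List ℕ} (π : IsPermList (suc N) c) (c₀ : nth c 0 ≡ 0) where

  private
    m : ℕ
    m = suc N

    index<m : ∀ {i} → i < m → index i c < m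
    index<m i< = <-≤-trans (proj₁ (index-∈ (perm-∈ π i<))) (≤-reflexive (length≡ π))

    nth-m : ∀ {k} → k ≡ m → nth c k ≡ 0
    nth-m k≡m = trans (cong (nth c) (trans k≡m (sym (length≡ π)))) (nth-overflow c)

    nth-inj : ∀ {i j} → i < m → j < m → nth c i ≡ nth c j → i ≡ j
    nth-inj i< j< = nth-injective (unique π) (subst (_ <_) (sym (length≡ π)) i<) (subst (_ <_) (sym (length≡ π)) j<)

    nth-suc≢0 : ∀ {k} → suc k < m → nth c (suc k) ≢ 0
    nth-suc≢0 k< eq = contradiction (nth-inj k< z<s (trans eq (sym c₀))) λ ()

    -- The default 0 read past the end causes no clash: within the list 0 occurs only at position 0,
    -- which is not a successor.
    nth-suc-injective : ∀ {i j} → i < m → j < m → nth c (suc i) ≡ nth c (suc j) → i ≡ j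
    nth-suc-injective {i} {j} i< j< eq with suc i <? m | suc j <? m
    ... | yes p | yes q = suc-injective (nth-inj p q eq)
    ... | yes p | no  q = contradiction (trans eq (nth-m (≤-antisym j< (≮⇒≥ q)))) (nth-suc≢0 p)
    ... | no  p | yes q = contradiction (trans (sym eq) (nth-m (≤-antisym i< (≮⇒≥ p)))) (nth-suc≢0 q)
    ... | no  p | no  q = suc-injective (trans (≤-antisym i< (≮⇒≥ p)) (sym (≤-antisym j< (≮⇒≥ q))))

  next< : ∀ {i} → i < m → next c i < m
  next< {i} i< with suc (index i c) <? m
  ... | yes p = perm-nth< π p
  ... | no  p = subst (_< m) (sym (nth-m (≤-antisym (index<m i<) (≮⇒≥ p)))) z<s

  next-injective : ∀ {i j} → i < m → j < m → next c i ≡ next c j → i ≡ j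
  next-injective {i} {j} i< j< eq = begin
    i                   ≡⟨ sym (proj₂ (index-∈ (perm-∈ π i<))) ⟩
    nth c (index i c)   ≡⟨ cong (nth c) (nth-suc-injective (index<m i<) (index<m j<) eq) ⟩
    nth c (index j c)   ≡⟨ proj₂ (index-∈ (perm-∈ π j<)) ⟩
    j                   ∎
    where open ≡-Reasoning

  v : Vec (Fin m) m
  v = tabulateℕ (next c)

  v-perm : T (isPerm v)
  v-perm = Unique⇒distinct (nth-injective⇒Unique (oneLine v) (λ {i} {j} i< j< eq →
    let i<m = subst (i <_) (length-oneLine v) i<
        j<m = subst (j <_) (length-oneLine v) j<
    in next-injective i<m j<m (trans (sym (nth-oneLine-tabulateℕ (next c) i<m (next< i<m)))
         (trans eq (nth-oneLine-tabulateℕ (next c) j<m (next< j<m))))))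

  open Orbits v v-perm public

  -- The case `k ≡ m` is included on purpose: there the default 0 expresses the return of the cycle
  -- to its start.
  toℕ-pow : ∀ {k} → k ≤ m → toℕ (pow f k zero) ≡ nth c k
  toℕ-pow {zero}  _   = sym c₀
  toℕ-pow {suc k} k<m = begin
    toℕ (pow f (suc k) zero)       ≡⟨ cong toℕ (pow-suc f k zero) ⟩
    toℕ (f (pow f k zero))         ≡⟨ toℕ-lookup-tabulateℕ (next c) (pow f k zero) (next< (toℕ<n (pow f k zero))) ⟩
    next c (toℕ (pow f k zero))    ≡⟨ cong (next c) (toℕ-pow (<⇒≤ k<m)) ⟩
    next c (nth c k)               ≡⟨ cong (nth c ∘ suc) (index-nth (unique π) (subst (k <_) (sym (length≡ π)) k<m)) ⟩
    nth c (suc k)                  ∎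
    where open ≡-Reasoning

  period-zero : Period f zero m
  period-zero = record
    { positive = z<s
    ; returns  = toℕ-injective (trans (toℕ-pow ≤-refl) (nth-m refl))
    ; minimal  = λ { {suc j} _ j< eq → nth-suc≢0 j< (trans (sym (toℕ-pow (<⇒≤ j<))) (cong toℕ eq)) }
    }

  orbit-zero : orbit v zero ≡ c
  orbit-zero = trans (orbit≡ period-zero) (nth-ext (trans (length-applyUpTo (trajectory zero) m) (sym (length≡ π)))
    (λ {i} i< → let i<m = subst (i <_) (length-applyUpTo (trajectory zero) m) i< in
      trans (nth-applyUpTo (trajectory zero) i<m) (toℕ-pow (<⇒≤ i<m))))

  reach : ∀ x → ∃ λ k → pow f k zero ≡ x
  reach x = let k< , eq = index-∈ (perm-∈ π (toℕ<n x)) in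
    index (toℕ x) c , toℕ-injective (trans (toℕ-pow (<⇒≤ (index<m (toℕ<n x)))) eq)

  length-orbit : ∀ x → length (orbit v x) ≡ m
  length-orbit x = let k , eq = reach x in
    trans (cong length (orbit≡ (subst (λ y → Period f y m) eq (period-pow f f-injective k period-zero))))
      (length-applyUpTo (trajectory x) m)

  -- Every point lies on the cycle of 0, so 0 belongs to its orbit and is smaller.
  no-other-min : ∀ (xs : List (Fin N)) → countTrue (isCycleMin v) (map suc xs) ≡ 0
  no-other-min []       = refl
  no-other-min (x ∷ xs) with isCycleMin v (suc x) in eq
  ... | false = no-other-min xs
  ... | true  = let k , e = reach (suc x) in contradiction
    (cycleMin-≤ {suc x} (subst T (sym eq) _) (subst (λ y → 0 ∈ orbit v y) e (∈-orbit-back {zero} k))) λ ()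

  Mperm≡ : Mperm v ≡ Mc c
  Mperm≡ = trans (tail-zero⇒Mperm≡ v v-perm
      (trans (cong (countTrue (isCycleMin v)) (sym (map-tabulate id suc))) (no-other-min (allFin N))))
    (cong Mc orbit-zero)

CyclePerm⇒inP : ∀ {n c} → CyclePerm n c → T (inP (suc (2 * n)) n (tabulateℕ (next c)))
CyclePerm⇒inP {n} (π , c₀ , M) = ∧⁺ v-perm (∧⁺
  (All.all⁻ (λ x → odd (length (orbit v x))) {allFin _} (All.universal (λ x →
    subst (T ∘ odd) (sym (length-orbit x))
      (Equivalence.from T-≡ (trans (cong (odd ∘ suc) (2*≡+ n)) (odd-suc-double n)))) _))
  (≡⇒≡ᵇ _ _ (trans Mperm≡ M)))
  where open Reconstruct π c₀

inP≃CyclePerm : ∀ n → (T ∘ inP (suc (2 * n)) n) ≃ CyclePerm n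
inP≃CyclePerm n = record
  { to        = λ v → orbit v zero
  ; from      = λ c → tabulateℕ (next c)
  ; to-pres   = λ {v} → inP⇒CyclePerm {n} {v}
  ; from-pres = CyclePerm⇒inP
  ; from-to   = λ {v} t → tabulateℕ-next-orbit v (proj₁ (∧⁻ {isPerm v} t)) (proj₁ (inP⇒CyclePerm {n} {v} t))
  ; to-from   = λ (π , c₀ , _) → Reconstruct.orbit-zero π c₀
  }

-- Single cycles and the factor 2

MiddleDesPerm : ℕ → List ℕ → Set
MiddleDesPerm k w = IsPermList (2 * suc k) w × (des w ≡ k ⊎ des w ≡ suc k)

CyclePerm≃MiddleDesPerm : ∀ k → CyclePerm (suc k) ≃ MiddleDesPerm k
CyclePerm≃MiddleDesPerm k = ≃-trans (deleteZero≃ (λ c → Mc c ≡ suc k))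
  (≃-id (λ {w} (π , M) → π , Sum.map (cD⇒des π) (cD⇒des π) (Mc≡n⇒ {0 ∷ map suc w} (len π) M))
        (λ {w} (π , d) → π , ⇒Mc≡n {0 ∷ map suc w} (len π) (Sum.map (des⇒cD π) (des⇒cD π) d)))
  where
  0<length : ∀ {w} → IsPermList (2 * suc k) w → 0 < length w
  0<length π = <-≤-trans z<s (≤-reflexive (sym (length≡ π)))

  cD⇒des : ∀ {w d} → IsPermList (2 * suc k) w → cD (0 ∷ map suc w) ≡ suc d → des w ≡ d
  cD⇒des {w} π = suc-injective ∘ trans (sym (cD-zero {w} (0<length π)))

  des⇒cD : ∀ {w d} → IsPermList (2 * suc k) w → des w ≡ d → cD (0 ∷ map suc w) ≡ suc d
  des⇒cD {w} π = trans (cD-zero {w} (0<length π)) ∘ cong suc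

  len : ∀ {w} → IsPermList (2 * suc k) w → length (0 ∷ map suc w) ≡ suc (2 * suc k)
  len {w} π = cong suc (trans (length-map suc w) (length≡ π))

-- A permutation of [2k+2] has `2k + 1` adjacent pairs, so reversal exchanges the two middle descent
-- numbers `k` and `suc k`.
MiddleDesPerm≃doubled : ∀ k → MiddleDesPerm k ≃ Doubled (DesPerm (2 * suc k) k)
MiddleDesPerm≃doubled k = involution-halves reverse high reverse-involutive
  (λ { (π , inj₁ d) _ → π , d
     ; {w} (π , inj₂ d) low → contradiction (trans (sym (high-true w d)) low) λ () })
  (λ { {w} (π , inj₁ d) hi → contradiction (trans (sym (high-false w d)) hi) λ ()
     ; (π , inj₂ d) _ → to-pres (DesPerm-reverse (middle-sum k)) (π , d) })
  (λ {w} (π , d) → (π , inj₁ d) , high-false w d)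
  (λ {w} q → let π , d = from-pres (DesPerm-reverse (middle-sum k)) q in
     (π , inj₂ d) , high-true (reverse w) d)
  where
  high : List ℕ → Bool
  high w = des w ≡ᵇ suc k

  high-true : ∀ w → des w ≡ suc k → high w ≡ true
  high-true w d = Equivalence.to T-≡ (≡⇒≡ᵇ (des w) (suc k) d)

  high-false : ∀ w → des w ≡ k → high w ≡ false
  high-false w d with des w ≡ᵇ suc k in eq
  ... | false = refl
  ... | true  = contradiction (trans (sym (≡ᵇ⇒≡ (des w) (suc k) (subst T (sym eq) _))) d) 1+n≢n

inP≃doubled-inE : ∀ k → let n = suc k in (T ∘ inP (suc (2 * n)) n) ≃ Doubled (T ∘ inE (2 * n) k)
inP≃doubled-inE k = ≃-trans (inP≃CyclePerm (suc k)) (≃-trans (CyclePerm≃MiddleDesPerm k)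
  (≃-trans (MiddleDesPerm≃doubled k) (Doubled-cong (≃-sym (inE≃DesPerm _ k)))))

-- The two counts and the bijection

theorem-suc : ∀ k → let n = suc k ; m = suc (2 * n) in
  (b m n ≡ EC n) × (p m n ≡ EC n) × (B m n ↔ P m n)
theorem-suc k =
  count-doubled (inB≃doubled-inE k) ,
  count-doubled (inP≃doubled-inE k) ,
  ≃⇒↔ (≃-trans (inB≃doubled-inE k) (≃-sym (inP≃doubled-inE k)))

theorem1p7 : (n : ℕ) →
    (b (2 * n + 1) n ≡ EC n) × (p (2 * n + 1) n ≡ EC n) × (B (2 * n + 1) n ↔ P (2 * n + 1) n)
-- Both counts evaluate to 1, so the two sets are numbered by the same `Fin 1`.
theorem1p7 zero =
  refl , refl , ↔-sym (Σ↔count-allVecs (inP 1 0)) ↔-∘ Σ↔count-allVecs (inB 1 0)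
theorem1p7 (suc k) =
  subst (λ m → (b m (suc k) ≡ EC (suc k)) × (p m (suc k) ≡ EC (suc k)) × (B m (suc k) ↔ P m (suc k)))
    (+-comm 1 (2 * suc k)) (theorem-suc k)
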